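{- Let $n\ge 3$ be a fixed integer. Then $m(v,n)\ge (c_{n-1}+o(1))\,v\log_2 v$, where $o(1)\to 0$ as $v\to\infty$ and $c_{t}$ (for $t\ge 2$) is the constant in the Kleitman--Spencer bound for binary covering arrays of strength $t$.
   Context: All graphs are finite and simple. A graph $G$ is $n$-existentially closed ($n$-e.c.) if for all subsets $S\subseteq V(G)$ with $|S|=n$ and all partitions $S=A\sqcup B$ (with $A$ or $B$ possibly empty), there exists a vertex in $V(G)\setminus S$ adjacent to all vertices in $A$ and to no vertices in $B$. $m(v,n)$ denotes the minimum number of edges in an $n$-e.c. graph with $v$ vertices. A binary covering array $\mathrm{CA}(N,k,t)$ is an $N\times k$ $\{0,1\}$-matrix such that every $N\times t$ submatrix contains every binary vector of length $t$ as some row. The constants $c_t$ come from the known theorem of Kleitman and Spencer: for fixed $t\ge 2$, if a $\mathrm{CA}(N,k,t)$ exists then $N\ge (c_t+o(1))\log_2 k$ (as $k\to\infty$), where $c_t$ is a constant with $c_2=1$ and, for $t\ge 3$, $$c_t\ge\frac{t-2}{(t-1)2^{1-t}-(1-2^{1-t})\log_2(1-2^{1-t})-2^{2-t}}.$$ -}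

module Defs where

open import Data.Bool.Base using (Bool; true; false; _∧_; if_then_else_)
open import Data.Fin.Base using (Fin)
open import Data.Fin.Properties using (_<?_)
open import Data.Fin.Subset using (Subset; _∈_; _∉_; _∩_; _∪_; ⊥; ∣_∣)
open import Data.Integer.Base as ℤ using (ℤ; +_)
import Data.Integer.Properties as ℤ
open import Data.Nat.Base as ℕ using (ℕ; zero; suc; _∸_; _^_; ⌊_/2⌋)
open import Data.Nat.Induction using (<-rec)
open import Data.Nat.Logarithm using (⌊log₂_⌋; ⌊log₂⌋-mono-≤; ⌊log₂⌊n/2⌋⌋≡⌊log₂n⌋∸1; ⌊log₂[2^n]⌋≡n)
import Data.Nat.Properties as ℕ
open import Data.Product.Base using (∃-syntax; _×_; _,_; proj₁; proj₂)
open import Data.Rational.Base as ℚ using (ℚ; mkℚ; 0ℚ; 1ℚ; ½; _/_; ↥_; ↧ₙ_)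
import Data.Rational.Properties as ℚ
open import Data.Rational.Solver using (module +-*-Solver)
import Data.Rational.Unnormalised.Base as ℚᵘ
import Data.Rational.Unnormalised.Properties as ℚᵘ
open import Data.Sum.Base using (inj₁; inj₂)
open import Function.Definitions using (Injective)
open import Relation.Binary.PropositionalEquality
open import Relation.Nullary.Decidable using (does)
open import Relation.Nullary.Negation using (contradiction)

-- A real number is a Cauchy sequence of rationals; operations are
-- termwise, and two sequences denote the same real when they are _≃ℝ_.

IsCauchy : (ℕ → ℚ) → Set
IsCauchy x = ∀ ε → 0ℚ ℚ.< ε →
  ∃[ N ] (∀ m n → N ℕ.≤ m → N ℕ.≤ n → ℚ.∣ x m ℚ.- x n ∣ ℚ.≤ ε)

record ℝ : Set where
  constructor mkℝ
  field
    seq    : ℕ → ℚ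
    cauchy : IsCauchy seq

open ℝ public

½ε+½ε : ∀ ε → ½ ℚ.* ε ℚ.+ ½ ℚ.* ε ≡ ε
½ε+½ε ε = trans (sym (ℚ.*-distribʳ-+ ε ½ ½)) (ℚ.*-identityˡ ε)

½ε>0 : ∀ {ε} → 0ℚ ℚ.< ε → 0ℚ ℚ.< ½ ℚ.* ε
½ε>0 {ε} ε>0 = ℚ.positive⁻¹ (½ ℚ.* ε) {{ℚ.pos*pos⇒pos ½ ε {{ℚ.positive ε>0}}}}

+-cauchy : ∀ {x y} → IsCauchy x → IsCauchy y → IsCauchy (λ n → x n ℚ.+ y n)
+-cauchy {x} {y} cx cy ε ε>0 =
  let N₁ , p = cx (½ ℚ.* ε) (½ε>0 ε>0)
      N₂ , q = cy (½ ℚ.* ε) (½ε>0 ε>0)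
  in N₁ ℕ.⊔ N₂ , λ m n N≤m N≤n → begin
    ℚ.∣ (x m ℚ.+ y m) ℚ.- (x n ℚ.+ y n) ∣
      ≡⟨ cong ℚ.∣_∣ (regroup (x m) (y m) (x n) (y n)) ⟩
    ℚ.∣ (x m ℚ.- x n) ℚ.+ (y m ℚ.- y n) ∣
      ≤⟨ ℚ.∣p+q∣≤∣p∣+∣q∣ (x m ℚ.- x n) (y m ℚ.- y n) ⟩
    ℚ.∣ x m ℚ.- x n ∣ ℚ.+ ℚ.∣ y m ℚ.- y n ∣
      ≤⟨ ℚ.+-mono-≤ (p m n (ℕ.m⊔n≤o⇒m≤o N₁ N₂ N≤m) (ℕ.m⊔n≤o⇒m≤o N₁ N₂ N≤n))
                    (q m n (ℕ.m⊔n≤o⇒n≤o N₁ N₂ N≤m) (ℕ.m⊔n≤o⇒n≤o N₁ N₂ N≤n)) ⟩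
    ½ ℚ.* ε ℚ.+ ½ ℚ.* ε
      ≡⟨ ½ε+½ε ε ⟩
    ε ∎
  where
  open ℚ.≤-Reasoning
  open +-*-Solver
  regroup : ∀ a b c d → (a ℚ.+ b) ℚ.- (c ℚ.+ d) ≡ (a ℚ.- c) ℚ.+ (b ℚ.- d)
  regroup = solve 4 (λ a b c d → (a :+ b) :- (c :+ d) := (a :- c) :+ (b :- d)) refl

neg-cauchy : ∀ {x} → IsCauchy x → IsCauchy (λ n → ℚ.- x n)
neg-cauchy {x} cx ε ε>0 =
  let N , p = cx ε ε>0
  in N , λ m n N≤m N≤n → subst (ℚ._≤ ε) (flip-sign m n) (p m n N≤m N≤n)
  where
  flip-sign : ∀ m n → ℚ.∣ x m ℚ.- x n ∣ ≡ ℚ.∣ (ℚ.- x m) ℚ.- (ℚ.- x n) ∣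
  flip-sign m n = trans (sym (ℚ.∣-p∣≡∣p∣ (x m ℚ.- x n)))
                        (cong ℚ.∣_∣ (ℚ.neg-distrib-+ (x m) (ℚ.- x n)))

cauchy⇒bounded : ∀ {x} → IsCauchy x →
  ∃[ B ] (0ℚ ℚ.< B × ∃[ N ] (∀ n → N ℕ.≤ n → ℚ.∣ x n ∣ ℚ.≤ B))
cauchy⇒bounded {x} cx =
  let N , p = cx 1ℚ (ℚ.positive⁻¹ 1ℚ)
      B = 1ℚ ℚ.+ ℚ.∣ x N ∣
  in B
   , ℚ.positive⁻¹ B {{ℚ.pos+nonNeg⇒pos 1ℚ ℚ.∣ x N ∣ {{ℚ.∣-∣-nonNeg (x N)}}}}
   , N
   , λ n N≤n → begin
       ℚ.∣ x n ∣
         ≡⟨ cong ℚ.∣_∣ (split (x n) (x N)) ⟩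
       ℚ.∣ (x n ℚ.- x N) ℚ.+ x N ∣
         ≤⟨ ℚ.∣p+q∣≤∣p∣+∣q∣ (x n ℚ.- x N) (x N) ⟩
       ℚ.∣ x n ℚ.- x N ∣ ℚ.+ ℚ.∣ x N ∣
         ≤⟨ ℚ.+-monoˡ-≤ ℚ.∣ x N ∣ (p n N N≤n ℕ.≤-refl) ⟩
       1ℚ ℚ.+ ℚ.∣ x N ∣ ∎
  where
  open ℚ.≤-Reasoning
  open +-*-Solver
  split : ∀ a b → a ≡ (a ℚ.- b) ℚ.+ b
  split = solve 2 (λ a b → a := (a :- b) :+ b) refl

∣p*q∣≤ : ∀ p q {a b} → 0ℚ ℚ.< a → ℚ.∣ p ∣ ℚ.≤ a → ℚ.∣ q ∣ ℚ.≤ b →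
         ℚ.∣ p ℚ.* q ∣ ℚ.≤ a ℚ.* b
∣p*q∣≤ p q {a} {b} a>0 p≤a q≤b = begin
  ℚ.∣ p ℚ.* q ∣
    ≡⟨ ℚ.∣p*q∣≡∣p∣*∣q∣ p q ⟩
  ℚ.∣ p ∣ ℚ.* ℚ.∣ q ∣
    ≤⟨ ℚ.*-monoʳ-≤-nonNeg ℚ.∣ q ∣ {{ℚ.∣-∣-nonNeg q}} p≤a ⟩
  a ℚ.* ℚ.∣ q ∣
    ≤⟨ ℚ.*-monoˡ-≤-nonNeg a {{ℚ.pos⇒nonNeg a {{ℚ.positive a>0}}}} q≤b ⟩
  a ℚ.* b ∎
  where open ℚ.≤-Reasoning

scale-to : ∀ B ε → 0ℚ ℚ.< B → 0ℚ ℚ.< ε → ∃[ η ] (0ℚ ℚ.< η × B ℚ.* η ≡ ε)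
scale-to B ε B>0 ε>0 =
  B⁻¹ ℚ.* ε
  , ℚ.positive⁻¹ (B⁻¹ ℚ.* ε)
      {{ℚ.pos*pos⇒pos B⁻¹ {{ℚ.1/pos⇒pos B}} ε {{ℚ.positive ε>0}}}}
  , trans (sym (ℚ.*-assoc B B⁻¹ ε))
      (trans (cong (ℚ._* ε) (ℚ.*-inverseʳ B)) (ℚ.*-identityˡ ε))
  where
  instance
    B-pos : ℚ.Positive B
    B-pos = ℚ.positive B>0
    B-nonZero : ℚ.NonZero B
    B-nonZero = ℚ.pos⇒nonZero B
  B⁻¹ : ℚ
  B⁻¹ = ℚ.1/ B

*-cauchy : ∀ {x y} → IsCauchy x → IsCauchy y → IsCauchy (λ n → x n ℚ.* y n)
*-cauchy {x} {y} cx cy ε ε>0 =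
  let A , A>0 , M₁ , x≤A = cauchy⇒bounded {x} cx
      B , B>0 , M₂ , y≤B = cauchy⇒bounded {y} cy
      η , η>0 , A*η = scale-to A (½ ℚ.* ε) A>0 (½ε>0 ε>0)
      θ , θ>0 , B*θ = scale-to B (½ ℚ.* ε) B>0 (½ε>0 ε>0)
      N₁ , p = cx θ θ>0
      N₂ , q = cy η η>0
      M = M₁ ℕ.⊔ M₂
      N = N₁ ℕ.⊔ N₂
  in M ℕ.⊔ N , λ m n le le′ →
    let M≤m = ℕ.m⊔n≤o⇒m≤o M N le
        M≤n = ℕ.m⊔n≤o⇒m≤o M N le′
        N≤m = ℕ.m⊔n≤o⇒n≤o M N le
        N≤n = ℕ.m⊔n≤o⇒n≤o M N le′
    in begin
    ℚ.∣ x m ℚ.* y m ℚ.- x n ℚ.* y n ∣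
      ≡⟨ cong ℚ.∣_∣ (regroup (x m) (y m) (x n) (y n)) ⟩
    ℚ.∣ x m ℚ.* (y m ℚ.- y n) ℚ.+ y n ℚ.* (x m ℚ.- x n) ∣
      ≤⟨ ℚ.∣p+q∣≤∣p∣+∣q∣ (x m ℚ.* (y m ℚ.- y n)) (y n ℚ.* (x m ℚ.- x n)) ⟩
    ℚ.∣ x m ℚ.* (y m ℚ.- y n) ∣ ℚ.+ ℚ.∣ y n ℚ.* (x m ℚ.- x n) ∣
      ≤⟨ ℚ.+-mono-≤
           (∣p*q∣≤ (x m) (y m ℚ.- y n) A>0 (x≤A m (ℕ.m⊔n≤o⇒m≤o M₁ M₂ M≤m))
              (q m n (ℕ.m⊔n≤o⇒n≤o N₁ N₂ N≤m) (ℕ.m⊔n≤o⇒n≤o N₁ N₂ N≤n)))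
           (∣p*q∣≤ (y n) (x m ℚ.- x n) B>0 (y≤B n (ℕ.m⊔n≤o⇒n≤o M₁ M₂ M≤n))
              (p m n (ℕ.m⊔n≤o⇒m≤o N₁ N₂ N≤m) (ℕ.m⊔n≤o⇒m≤o N₁ N₂ N≤n))) ⟩
    A ℚ.* η ℚ.+ B ℚ.* θ
      ≡⟨ cong₂ ℚ._+_ A*η B*θ ⟩
    ½ ℚ.* ε ℚ.+ ½ ℚ.* ε
      ≡⟨ ½ε+½ε ε ⟩
    ε ∎
  where
  open ℚ.≤-Reasoning
  open +-*-Solver
  regroup : ∀ a b c d →
    a ℚ.* b ℚ.- c ℚ.* d ≡ a ℚ.* (b ℚ.- d) ℚ.+ d ℚ.* (a ℚ.- c)
  regroup = solve 4 (λ a b c d →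
    a :* b :- c :* d := a :* (b :- d) :+ d :* (a :- c)) refl

fromℚ : ℚ → ℝ
fromℚ q .seq _ = q
fromℚ q .cauchy ε ε>0 = 0 , λ _ _ _ _ →
  subst (ℚ._≤ ε) (cong ℚ.∣_∣ (sym (ℚ.+-inverseʳ q))) (ℚ.<⇒≤ ε>0)

fromℕ : ℕ → ℝ
fromℕ n = fromℚ (+ n / 1)

infixl 7 _*ℝ_
infixl 6 _+ℝ_ _-ℝ_
infix  8 -ℝ_
infix  4 _≤ℝ_ _≥ℝ_ _≃ℝ_

_+ℝ_ : ℝ → ℝ → ℝ
(x +ℝ y) .seq n  = seq x n ℚ.+ seq y n
(x +ℝ y) .cauchy = +-cauchy {seq x} {seq y} (cauchy x) (cauchy y)

-ℝ_ : ℝ → ℝ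
(-ℝ x) .seq n  = ℚ.- seq x n
(-ℝ x) .cauchy = neg-cauchy {seq x} (cauchy x)

_-ℝ_ : ℝ → ℝ → ℝ
x -ℝ y = x +ℝ (-ℝ y)

_*ℝ_ : ℝ → ℝ → ℝ
(x *ℝ y) .seq n  = seq x n ℚ.* seq y n
(x *ℝ y) .cauchy = *-cauchy {seq x} {seq y} (cauchy x) (cauchy y)

_≤ℝ_ : ℝ → ℝ → Set
x ≤ℝ y = ∀ ε → 0ℚ ℚ.< ε → ∃[ N ] (∀ n → N ℕ.≤ n → seq x n ℚ.≤ seq y n ℚ.+ ε)

_≥ℝ_ : ℝ → ℝ → Set
x ≥ℝ y = y ≤ℝ x

_≃ℝ_ : ℝ → ℝ → Set
x ≃ℝ y = x ≤ℝ y × y ≤ℝ x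

2^⌊log₂n⌋≤n : ∀ n → .{{_ : ℕ.NonZero n}} → 2 ^ ⌊log₂ n ⌋ ℕ.≤ n
2^⌊log₂n⌋≤n n = <-rec (λ n → 1 ℕ.≤ n → 2 ^ ⌊log₂ n ⌋ ℕ.≤ n) step n (ℕ.>-nonZero⁻¹ n)
  where
  open ℕ.≤-Reasoning
  2*⌊n/2⌋≤n : ∀ n → 2 ℕ.* ⌊ n /2⌋ ℕ.≤ n
  2*⌊n/2⌋≤n n = begin
    2 ℕ.* ⌊ n /2⌋           ≡⟨ cong (⌊ n /2⌋ ℕ.+_) (ℕ.+-identityʳ ⌊ n /2⌋) ⟩
    ⌊ n /2⌋ ℕ.+ ⌊ n /2⌋     ≤⟨ ℕ.+-monoʳ-≤ ⌊ n /2⌋ (ℕ.⌊n/2⌋≤⌈n/2⌉ n) ⟩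
    ⌊ n /2⌋ ℕ.+ ℕ.⌈ n /2⌉   ≡⟨ ℕ.⌊n/2⌋+⌈n/2⌉≡n n ⟩
    n                       ∎
  step : ∀ n → (∀ {m} → m ℕ.< n → 1 ℕ.≤ m → 2 ^ ⌊log₂ m ⌋ ℕ.≤ m) →
         1 ℕ.≤ n → 2 ^ ⌊log₂ n ⌋ ℕ.≤ n
  step 1 _ _ = ℕ.≤-refl
  step n@(suc (suc k)) ih _ = begin
    2 ^ ⌊log₂ n ⌋
      ≡⟨ cong (2 ^_) (ℕ.suc-pred ⌊log₂ n ⌋ {{ℕ.>-nonZero 1≤log}}) ⟨
    2 ℕ.* 2 ^ ℕ.pred ⌊log₂ n ⌋
      ≡⟨ cong (λ e → 2 ℕ.* 2 ^ e) (⌊log₂⌊n/2⌋⌋≡⌊log₂n⌋∸1 n) ⟨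
    2 ℕ.* 2 ^ ⌊log₂ ⌊ n /2⌋ ⌋
      ≤⟨ ℕ.*-monoʳ-≤ 2 (ih (ℕ.⌊n/2⌋<n (suc k)) (ℕ.s≤s ℕ.z≤n)) ⟩
    2 ℕ.* ⌊ n /2⌋
      ≤⟨ 2*⌊n/2⌋≤n n ⟩
    n ∎
    where
    1≤log : 1 ℕ.≤ ⌊log₂ n ⌋
    1≤log = ⌊log₂⌋-mono-≤ {2} {n} (ℕ.s≤s (ℕ.s≤s ℕ.z≤n))

n<2^[1+⌊log₂n⌋] : ∀ n → n ℕ.< 2 ^ suc ⌊log₂ n ⌋
n<2^[1+⌊log₂n⌋] n = ℕ.≰⇒> λ 2^≤n → ℕ.1+n≰n
  (subst (ℕ._≤ ⌊log₂ n ⌋) (⌊log₂[2^n]⌋≡n (suc ⌊log₂ n ⌋)) (⌊log₂⌋-mono-≤ 2^≤n))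

/-mono-≤ : ∀ a b m n → a ℕ.* suc n ℕ.≤ b ℕ.* suc m → + a / suc m ℚ.≤ + b / suc n
/-mono-≤ a b m n le = ℚ.toℚᵘ-cancel-≤ (begin
  ℚ.toℚᵘ (+ a / suc m)  ≃⟨ ℚ.toℚᵘ-fromℚᵘ (ℚᵘ.mkℚᵘ (+ a) m) ⟩
  ℚᵘ.mkℚᵘ (+ a) m       ≤⟨ ℚᵘ.*≤* (subst₂ ℤ._≤_ (ℤ.pos-* a (suc n)) (ℤ.pos-* b (suc m)) (ℤ.+≤+ le)) ⟩
  ℚᵘ.mkℚᵘ (+ b) n       ≃⟨ ℚ.toℚᵘ-fromℚᵘ (ℚᵘ.mkℚᵘ (+ b) n) ⟨
  ℚ.toℚᵘ (+ b / suc n)  ∎)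
  where open ℚᵘ.≤-Reasoning

suc-/ : ∀ b n → + suc b / suc n ≡ + b / suc n ℚ.+ + 1 / suc n
suc-/ b n = ℚ.toℚᵘ-injective (begin
  ℚ.toℚᵘ (+ suc b / suc n)
    ≈⟨ ℚ.toℚᵘ-fromℚᵘ (ℚᵘ.mkℚᵘ (+ suc b) n) ⟩
  ℚᵘ.mkℚᵘ (+ suc b) n
    ≈⟨ ℚᵘ.*≡* cross ⟩
  ℚᵘ.mkℚᵘ (+ b) n ℚᵘ.+ ℚᵘ.mkℚᵘ (+ 1) n
    ≈⟨ ℚᵘ.+-cong (ℚ.toℚᵘ-fromℚᵘ (ℚᵘ.mkℚᵘ (+ b) n)) (ℚ.toℚᵘ-fromℚᵘ (ℚᵘ.mkℚᵘ (+ 1) n)) ⟨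
  ℚ.toℚᵘ (+ b / suc n) ℚᵘ.+ ℚ.toℚᵘ (+ 1 / suc n)
    ≈⟨ ℚ.toℚᵘ-homo-+ (+ b / suc n) (+ 1 / suc n) ⟨
  ℚ.toℚᵘ (+ b / suc n ℚ.+ + 1 / suc n) ∎)
  where
  open import Relation.Binary.Reasoning.Setoid ℚᵘ.≃-setoid
  d = + suc n
  cross : + suc b ℤ.* (d ℤ.* d) ≡ (+ b ℤ.* d ℤ.+ + 1 ℤ.* d) ℤ.* d
  cross = trans (cong (ℤ._* (d ℤ.* d)) (cong +_ (ℕ.+-comm 1 b)))
    (trans (sym (ℤ.*-assoc (+ b ℤ.+ + 1) d d))
           (cong (ℤ._* d) (ℤ.*-distribʳ-+ d (+ b) (+ 1))))

-- ⌊ (m+1) log₂ k ⌋ / (m+1), which lies within 1/(m+1) below log₂ k.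
log₂-seq : ℕ → ℕ → ℚ
log₂-seq k m = + ⌊log₂ (k ^ suc m) ⌋ / suc m

log₂-seq-≤ : ∀ k m n → .{{_ : ℕ.NonZero k}} →
  log₂-seq k m ℚ.≤ log₂-seq k n ℚ.+ + 1 / suc n
log₂-seq-≤ k m n = subst (log₂-seq k m ℚ.≤_) (suc-/ b n)
  (/-mono-≤ a (suc b) m n (ℕ.<⇒≤ a*n<[1+b]*m))
  where
  a = ⌊log₂ (k ^ suc m) ⌋
  b = ⌊log₂ (k ^ suc n) ⌋
  2^< : 2 ^ (a ℕ.* suc n) ℕ.< 2 ^ (suc b ℕ.* suc m)
  2^< = begin-strict
    2 ^ (a ℕ.* suc n)      ≡⟨ ℕ.^-*-assoc 2 a (suc n) ⟨
    (2 ^ a) ^ suc n        ≤⟨ ℕ.^-monoˡ-≤ (suc n) (2^⌊log₂n⌋≤n (k ^ suc m) {{ℕ.m^n≢0 k (suc m)}}) ⟩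
    (k ^ suc m) ^ suc n    ≡⟨ ℕ.^-*-assoc k (suc m) (suc n) ⟩
    k ^ (suc m ℕ.* suc n)  ≡⟨ cong (k ^_) (ℕ.*-comm (suc m) (suc n)) ⟩
    k ^ (suc n ℕ.* suc m)  ≡⟨ ℕ.^-*-assoc k (suc n) (suc m) ⟨
    (k ^ suc n) ^ suc m    <⟨ ℕ.^-monoˡ-< (suc m) (n<2^[1+⌊log₂n⌋] (k ^ suc n)) ⟩
    (2 ^ suc b) ^ suc m    ≡⟨ ℕ.^-*-assoc 2 (suc b) (suc m) ⟩
    2 ^ (suc b ℕ.* suc m)  ∎
    where open ℕ.≤-Reasoning
  a*n<[1+b]*m : a ℕ.* suc n ℕ.< suc b ℕ.* suc m
  a*n<[1+b]*m = ℕ.≰⇒> λ ge → ℕ.<⇒≱ 2^< (ℕ.^-monoʳ-≤ 2 ge)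

1/-archimedean : ∀ ε → 0ℚ ℚ.< ε → ∃[ N ] (∀ n → N ℕ.≤ n → + 1 / suc n ℚ.≤ ε)
1/-archimedean (mkℚ (+ zero) d c) ε>0 = contradiction (ℚ.positive ε>0) λ ()
1/-archimedean (mkℚ ℤ.-[1+ p ] d c) ε>0 = contradiction (ℚ.positive ε>0) λ ()
1/-archimedean ε@(mkℚ (+ suc p) d c) ε>0 = d , λ n d≤n →
  subst (+ 1 / suc n ℚ.≤_) (ℚ.fromℚᵘ-toℚᵘ ε) (/-mono-≤ 1 (suc p) n d (begin
    1 ℕ.* suc d      ≡⟨ ℕ.*-identityˡ (suc d) ⟩
    suc d            ≤⟨ ℕ.s≤s d≤n ⟩
    suc n            ≤⟨ ℕ.m≤n*m (suc n) (suc p) ⟩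
    suc p ℕ.* suc n  ∎))
  where open ℕ.≤-Reasoning

p≤q+r⇒p-q≤r : ∀ p q {r} → p ℚ.≤ q ℚ.+ r → p ℚ.- q ℚ.≤ r
p≤q+r⇒p-q≤r p q {r} p≤q+r =
  subst (p ℚ.- q ℚ.≤_) (cancel q r) (ℚ.+-monoˡ-≤ (ℚ.- q) p≤q+r)
  where
  open +-*-Solver
  cancel : ∀ q r → (q ℚ.+ r) ℚ.- q ≡ r
  cancel = solve 2 (λ q r → (q :+ r) :- q := r) refl

log₂-cauchy : ∀ k → .{{_ : ℕ.NonZero k}} → IsCauchy (log₂-seq k)
log₂-cauchy k ε ε>0 =
  let N , 1/≤ε = 1/-archimedean ε ε>0
      close : ∀ m n → N ℕ.≤ n → log₂-seq k m ℚ.- log₂-seq k n ℚ.≤ ε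
      close m n N≤n = p≤q+r⇒p-q≤r (log₂-seq k m) (log₂-seq k n)
        (ℚ.≤-trans (log₂-seq-≤ k m n) (ℚ.+-monoʳ-≤ (log₂-seq k n) (1/≤ε n N≤n)))
  in N , λ m n N≤m N≤n →
     ∣-∣≤ (log₂-seq k m) (log₂-seq k n) (close m n N≤n) (close n m N≤m)
  where
  open +-*-Solver
  neg-sub : ∀ p q → ℚ.- (p ℚ.- q) ≡ q ℚ.- p
  neg-sub = solve 2 (λ p q → :- (p :- q) := q :- p) refl
  ∣-∣≤ : ∀ p q → p ℚ.- q ℚ.≤ ε → q ℚ.- p ℚ.≤ ε → ℚ.∣ p ℚ.- q ∣ ℚ.≤ ε
  ∣-∣≤ p q p-q≤ε q-p≤ε with ℚ.∣p∣≡p∨∣p∣≡-p (p ℚ.- q)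
  ... | inj₁ eq = subst (ℚ._≤ ε) (sym eq) p-q≤ε
  ... | inj₂ eq = subst (ℚ._≤ ε) (sym (trans eq (neg-sub p q))) q-p≤ε

-- The value at 0 is a dummy.
log₂ : ℕ → ℝ
log₂ zero      = fromℚ 0ℚ
log₂ k@(suc _) = mkℝ (log₂-seq k) (log₂-cauchy k)

-- Meaningful only for positive arguments.
log₂ℚ : ℚ → ℝ
log₂ℚ q = log₂ ℤ.∣ ↥ q ∣ -ℝ log₂ (↧ₙ q)

_IsLittleO1 : (ℕ → ℝ) → Set
f IsLittleO1 = ∀ ε → 0ℚ ℚ.< ε →
  ∃[ K ] (∀ k → K ℕ.≤ k → fromℚ (ℚ.- ε) ≤ℝ f k × f k ≤ℝ fromℚ ε)

Matrix : ℕ → ℕ → Set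
Matrix N k = Fin N → Fin k → Bool

-- The injection γ selects the t columns of an N × t submatrix.
IsCoveringArray : ∀ {N k} → ℕ → Matrix N k → Set
IsCoveringArray {N} {k} t M =
  (γ : Fin t → Fin k) → Injective _≡_ _≡_ γ →
  (w : Fin t → Bool) → ∃[ r ] (∀ j → M r (γ j) ≡ w j)

CA : ℕ → ℕ → ℕ → Set
CA N k t = ∃[ M ] IsCoveringArray {N} {k} t M

CoveringArrayBound : ℕ → ℝ → Set
CoveringArrayBound t c =
  ∃[ δ ] (δ IsLittleO1 ×
  ∃[ K ] (∀ k N → K ℕ.≤ k → CA N k t →
            fromℕ N ≥ℝ (c +ℝ δ k) *ℝ log₂ k))

2⁻ : ℕ → ℚ
2⁻ k = (+ 1 / (2 ^ k)) {{ℕ.m^n≢0 2 k}}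

-- The denominator of the Kleitman–Spencer lower bound for c_t; it is
-- positive for t ≥ 3.
ksDenominator : ℕ → ℝ
ksDenominator t =
  fromℚ ((+ (t ∸ 1) / 1) ℚ.* x) -ℝ fromℚ (1ℚ ℚ.- x) *ℝ log₂ℚ (1ℚ ℚ.- x) -ℝ fromℚ (2⁻ (t ∸ 2))
  where
  x = 2⁻ (t ∸ 1)

-- c_t is specified by the Kleitman–Spencer theorem: the asymptotic bound,
-- c_2 = 1, and c_t ≥ (t-2)/D for t ≥ 3, with the denominator D cleared.
-- A product rather than a record: the positivity check of a record would
-- normalise the rational arithmetic in ksDenominator.
KleitmanSpencer : (ℕ → ℝ) → Set
KleitmanSpencer c =
  (∀ t → 2 ℕ.≤ t → CoveringArrayBound t (c t)) ×
  c 2 ≃ℝ fromℕ 1 ×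
  (∀ t → 3 ℕ.≤ t → c t *ℝ ksDenominator t ≥ℝ fromℕ (t ∸ 2))

record Graph (v : ℕ) : Set where
  field
    adj    : Fin v → Fin v → Bool
    symm   : ∀ x y → adj x y ≡ adj y x
    irrefl : ∀ x → adj x x ≡ false

open Graph public

∣E_∣ : ∀ {v} → Graph v → ℕ
∣E_∣ {v} G = ∑[ i < v ] ∑[ j < v ] (if does (i <? j) ∧ adj G i j then 1 else 0)
  where open import Algebra.Properties.CommutativeMonoid.Sum ℕ.+-0-commutativeMonoid

IsExistentiallyClosed : ∀ {v} → ℕ → Graph v → Set
IsExistentiallyClosed {v} n G =
  (S A B : Subset v) → ∣ S ∣ ≡ n → A ∪ B ≡ S → A ∩ B ≡ ⊥ →
  ∃[ x ] (x ∉ S ×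
          (∀ a → a ∈ A → adj G x a ≡ true) ×
          (∀ b → b ∈ B → adj G x b ≡ false))

-- "m(v,n) = e", as a relation because m(v,n) is undefined when no n-e.c.
-- graph on v vertices exists.
IsMinEdges : ℕ → ℕ → ℕ → Set
IsMinEdges v n e =
  (∃[ G ] (IsExistentiallyClosed {v} n G × ∣E G ∣ ≡ e)) ×
  (∀ (G : Graph v) → IsExistentiallyClosed n G → e ℕ.≤ ∣E G ∣)

{-# OPTIONS --safe #-}

-- Call a vertex low if its degree is at most D, where D ≈ √v. The low
-- neighbours of a low vertex x touch at most D² vertices; on the remaining
-- vertices z ≠ x the rows of the adjacency matrix indexed by N(x) form, by
-- n-existential closure, a covering array of strength n − 1 whose low rows
-- vanish. So x has at least (c_{n-1} + o(1)) log₂ v neighbours that are high.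
-- Edges between low and high vertices are counted only once in the sum of
-- these numbers, which is where the factor 1/2 of the usual degree count is
-- saved. The number of high vertices is at most 2e/D = o(v) unless e is
-- already larger than claimed.
module Submission where

open import Defs
open import Data.Bool.Base using (Bool; true; false; _∧_; not; if_then_else_)
import Data.Bool.Properties as Bool
open import Data.Fin.Base using (Fin; zero; suc; inject≤)
open import Data.Fin.Properties using (_≟_; _<?_; any?; <-cmp; inject≤-injective; suc-injective)
open import Data.Fin.Subset using (Subset; _∈_; _∩_; _∪_; ⊥; ∣_∣)
open import Data.Fin.Subset.Properties using (Empty-unique; x∈p∩q⁻; x∈p∪q⁺; x∈p∪q⁻)
open import Data.Integer.Base as ℤ using (+_)
import Data.Integer.Properties as ℤ
open import Data.Nat.Base as ℕ hiding (_/_)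
open import Data.Nat.Logarithm using (⌊log₂_⌋; ⌊log₂⌋-mono-≤; ⌊log₂[2^n]⌋≡n)
open import Data.Nat.Properties as ℕ hiding (_≟_; _<?_; <-cmp; suc-injective; 0≢1+n)
open import Data.Nat.Tactic.RingSolver using (solve-∀)
open import Data.Product.Base using (∃-syntax; _×_; _,_; proj₁; proj₂)
open import Data.Rational.Base as ℚ using (ℚ; mkℚ; 0ℚ; 1ℚ; _/_)
import Data.Rational.Properties as ℚ
open import Data.Rational.Solver using (module +-*-Solver)
open import Data.Rational.Unnormalised.Base as ℚᵘ using (mkℚᵘ)
import Data.Rational.Unnormalised.Properties as ℚᵘ
open import Data.Sum.Base using (_⊎_; inj₁; inj₂)
open import Data.Vec.Base using (lookup; tabulate; _∷_; [])
open import Data.Vec.Properties using (lookup∘tabulate; []=⇒lookup; lookup⇒[]=)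
open import Function.Base using (_∘_)
open import Function.Definitions using (Injective)
open import Relation.Binary.Definitions using (tri<; tri≈; tri>)
open import Relation.Binary.PropositionalEquality hiding (J)
open import Relation.Nullary.Decidable using (Dec; yes; no; does; dec-true; dec-false; _×-dec_)
open import Relation.Nullary.Negation using (¬_; contradiction)

open import Algebra.Properties.Semiring.Sum ℕ.+-*-semiring

-- Sums and finite sets

⟦_⟧ : Bool → ℕ
⟦ b ⟧ = if b then 1 else 0

∑-mono : ∀ {n} {f g : Fin n → ℕ} → (∀ i → f i ≤ g i) → sum f ≤ sum g
∑-mono {zero}  f≤g = z≤n
∑-mono {suc n} f≤g = +-mono-≤ (f≤g zero) (∑-mono (f≤g ∘ suc))

∑-const : ∀ n c → ∑[ i < n ] c ≡ n * c
∑-const zero    c = refl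
∑-const (suc n) c = cong (c ℕ.+_) (∑-const n c)

term≤∑ : ∀ {n} (f : Fin n → ℕ) i → f i ≤ sum f
term≤∑ f zero    = m≤m+n (f zero) _
term≤∑ f (suc i) = ≤-trans (term≤∑ (f ∘ suc) i) (m≤n+m _ (f zero))

∑-indicator : ∀ {n} (i : Fin n) → ∑[ j < n ] ⟦ does (i ≟ j) ⟧ ≡ 1
∑-indicator {suc n} zero    = cong suc (sum-replicate-zero n)
∑-indicator {suc n} (suc i) = ∑-indicator i

does-true : ∀ {p} {P : Set p} (P? : Dec P) → does P? ≡ true → P
does-true (yes p) _ = p

does-false : ∀ {p} {P : Set p} (P? : Dec P) → does P? ≡ false → ¬ P
does-false (no ¬p) _ = ¬p

count : ∀ {n} → (Fin n → Bool) → ℕ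
count {n} p = ∑[ i < n ] ⟦ p i ⟧

⟦b⟧+⟦not-b⟧≡1 : ∀ b → ⟦ b ⟧ + ⟦ not b ⟧ ≡ 1
⟦b⟧+⟦not-b⟧≡1 true  = refl
⟦b⟧+⟦not-b⟧≡1 false = refl

count+count-not≡n : ∀ {n} (p : Fin n → Bool) → count p + count (not ∘ p) ≡ n
count+count-not≡n {n} p = begin
  count p + count (not ∘ p)              ≡⟨ ∑-distrib-+ (⟦_⟧ ∘ p) (⟦_⟧ ∘ not ∘ p) ⟨
  ∑[ i < n ] (⟦ p i ⟧ + ⟦ not (p i) ⟧)   ≡⟨ sum-cong-≗ (⟦b⟧+⟦not-b⟧≡1 ∘ p) ⟩
  ∑[ i < n ] 1                           ≡⟨ ∑-const n 1 ⟩
  n * 1                                  ≡⟨ *-identityʳ n ⟩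
  n                                      ∎
  where open ≡-Reasoning

enumerate : ∀ {n} (p : Fin n → Bool) →
  ∃[ f ] (Injective {A = Fin (count p)} _≡_ _≡_ f ×
          (∀ i → p (f i) ≡ true) ×
          (∀ z → p z ≡ true → ∃[ i ] f i ≡ z))
enumerate {zero}  p = (λ ()) , (λ { {()} }) , (λ ()) , λ ()
enumerate {suc n} p with p zero in p0 | enumerate (p ∘ suc)
... | false | f , f-inj , f-true , f-onto =
  suc ∘ f , f-inj ∘ suc-injective , f-true ,
  λ { zero    p0≡true → contradiction (trans (sym p0) p0≡true) λ ()
    ; (suc z) pz → let i , eq = f-onto z pz in i , cong suc eq }
... | true  | f , f-inj , f-true , f-onto = f′ , f′-inj , f′-true , f′-onto
  where
  f′ : Fin (suc (count (p ∘ suc))) → Fin (suc n)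
  f′ zero    = zero
  f′ (suc i) = suc (f i)
  f′-inj : Injective _≡_ _≡_ f′
  f′-inj {zero}  {zero}  eq = refl
  f′-inj {suc i} {suc j} eq = cong suc (f-inj (suc-injective eq))
  f′-true : ∀ i → p (f′ i) ≡ true
  f′-true zero    = p0
  f′-true (suc i) = f-true i
  f′-onto : ∀ z → p z ≡ true → ∃[ i ] f′ i ≡ z
  f′-onto zero    _  = zero , refl
  f′-onto (suc z) pz = let i , eq = f-onto z pz in suc i , cong suc eq

∣p∣≡count : ∀ {n} (p : Subset n) → ∣ p ∣ ≡ count (lookup p)
∣p∣≡count []          = refl
∣p∣≡count (true  ∷ p) = cong suc (∣p∣≡count p)
∣p∣≡count (false ∷ p) = ∣p∣≡count p

-- Prescribed adjacency to an injective tuple of vertices.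

module _ {n v} (g : Fin n → Fin v) (g-inj : Injective _≡_ _≡_ g) where

  image∩? : (w : Fin n → Bool) (b : Bool) (z : Fin v) → Dec (∃[ i ] (g i ≡ z × w i ≡ b))
  image∩? w b z = any? λ i → (g i ≟ z) ×-dec (w i Bool.≟ b)

  image : (Fin n → Bool) → Bool → Subset v
  image w b = tabulate (does ∘ image∩? w b)

  ∈-image⁺ : ∀ w i → g i ∈ image w (w i)
  ∈-image⁺ w i = lookup⇒[]= (g i) _ (trans (lookup∘tabulate _ (g i))
    (dec-true (image∩? w (w i) (g i)) (i , refl , refl)))

  ∈-image⁻ : ∀ w b {z} → z ∈ image w b → ∃[ i ] (g i ≡ z × w i ≡ b)
  ∈-image⁻ w b {z} z∈ with image∩? w b z | trans (sym (lookup∘tabulate (does ∘ image∩? w b) z)) ([]=⇒lookup z∈)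
  ... | yes p | _ = p

  image-split : (Fin n → Bool) → Subset v
  image-split w = image w true ∪ image w false

  private
    -- Injectivity gives each point of the image exactly one preimage. Membership thereby becomes a
    -- sum over indices, and `∣image-split∣` follows by exchanging two sums.
    indicator : ∀ w z → ⟦ lookup (image-split w) z ⟧ ≡ ∑[ i < n ] ⟦ does (g i ≟ z) ⟧
    indicator w z with lookup (image-split w) z in eq
    ... | true = sym (trans (sum-cong-≗ same) (∑-indicator i₀))
      where
      preimage : ∃[ i ] g i ≡ z
      preimage with x∈p∪q⁻ (image w true) (image w false) (lookup⇒[]= z _ eq)
      ... | inj₁ z∈ = let i , e , _ = ∈-image⁻ w true z∈ in i , e
      ... | inj₂ z∈ = let i , e , _ = ∈-image⁻ w false z∈ in i , e
      i₀ = proj₁ preimage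
      same : ∀ i → ⟦ does (g i ≟ z) ⟧ ≡ ⟦ does (i₀ ≟ i) ⟧
      same i with i₀ ≟ i
      ... | yes refl = cong ⟦_⟧ (dec-true (g i ≟ z) (proj₂ preimage))
      ... | no i₀≢i  = cong ⟦_⟧ (dec-false (g i ≟ z) λ e →
                         i₀≢i (g-inj (trans (proj₂ preimage) (sym e))))
    ... | false = sym (trans (sum-cong-≗ none) (sum-replicate-zero n))
      where
      none : ∀ i → ⟦ does (g i ≟ z) ⟧ ≡ 0
      none i = cong ⟦_⟧ (dec-false (g i ≟ z) λ { refl →
        contradiction (trans (sym eq) ([]=⇒lookup (x∈p∪q⁺ (either i)))) λ () })
        where
        either : ∀ i → g i ∈ image w true ⊎ g i ∈ image w false
        either i with w i | ∈-image⁺ w i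
        ... | true  | z∈ = inj₁ z∈
        ... | false | z∈ = inj₂ z∈

  ∣image-split∣ : ∀ w → ∣ image-split w ∣ ≡ n
  ∣image-split∣ w = begin
    ∣ image-split w ∣                              ≡⟨ ∣p∣≡count (image-split w) ⟩
    ∑[ z < v ] ⟦ lookup (image-split w) z ⟧        ≡⟨ sum-cong-≗ (indicator w) ⟩
    ∑[ z < v ] ∑[ i < n ] ⟦ does (g i ≟ z) ⟧       ≡⟨ ∑-comm (λ z i → ⟦ does (g i ≟ z) ⟧) ⟩
    ∑[ i < n ] ∑[ z < v ] ⟦ does (g i ≟ z) ⟧       ≡⟨ sum-cong-≗ (∑-indicator ∘ g) ⟩
    ∑[ i < n ] 1                                   ≡⟨ ∑-const n 1 ⟩
    n * 1                                          ≡⟨ *-identityʳ n ⟩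
    n                                              ∎
    where open ≡-Reasoning

  image-disjoint : ∀ w → image w true ∩ image w false ≡ ⊥
  image-disjoint w = Empty-unique λ (z , z∈) →
    let z∈A , z∈B = x∈p∩q⁻ (image w true) (image w false) z∈
        i , gi≡z , wi = ∈-image⁻ w true z∈A
        j , gj≡z , wj = ∈-image⁻ w false z∈B
        i≡j = g-inj (trans gi≡z (sym gj≡z))
    in contradiction (trans (sym wi) (trans (cong w i≡j) wj)) λ ()

  -- Translates from subsets to functions: the image of `g` is partitioned according to the bits
  -- `w`. In this form a witness can be read as a row of a matrix.
  ec-witness : (G : Graph v) → IsExistentiallyClosed n G →
    (w : Fin n → Bool) → ∃[ y ] (∀ i → adj G y (g i) ≡ w i)
  ec-witness G ec w =
    let y , _ , A-adj , B-nonadj = ec (image-split w) (image w true) (image w false)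
                                      (∣image-split∣ w) refl (image-disjoint w)
        match : ∀ i → adj G y (g i) ≡ w i
        match i = match′ (w i) (A-adj (g i)) (B-nonadj (g i)) (∈-image⁺ w i)
    in y , match
    where
    match′ : ∀ {y z} b → (z ∈ image w true → adj G y z ≡ true) →
             (z ∈ image w false → adj G y z ≡ false) → z ∈ image w b → adj G y z ≡ b
    match′ true  a _ = a
    match′ false _ b = b

-- Degree sums.

module _ {v} (G : Graph v) where

  deg : Fin v → ℕ
  deg x = count (adj G x)

  -- Double counting by unordered pairs: the two orders of a pair are charged together to the edge
  -- joining them, and `c` is the charge allowed per edge.
  ∑∑≤edges : ∀ c (f : Fin v → Fin v → ℕ) → (∀ i → f i i ≡ 0) →
    (∀ i j → f i j + f j i ≤ c * ⟦ adj G i j ⟧) →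
    ∑[ i < v ] ∑[ j < v ] f i j ≤ c * ∣E G ∣
  ∑∑≤edges c f diag pair = begin
    ∑[ i < v ] ∑[ j < v ] f i j
      ≡⟨ sum-cong-≗ (λ i → sum-cong-≗ (λ j → split i j)) ⟩
    ∑[ i < v ] ∑[ j < v ] (upper i j + lower i j)
      ≡⟨ sum-cong-≗ (λ i → ∑-distrib-+ (upper i) (lower i)) ⟩
    ∑[ i < v ] (∑[ j < v ] upper i j + ∑[ j < v ] lower i j)
      ≡⟨ ∑-distrib-+ (λ i → sum (upper i)) (λ i → sum (lower i)) ⟩
    ∑[ i < v ] ∑[ j < v ] upper i j + ∑[ i < v ] ∑[ j < v ] lower i j
      -- Exchanging the sums reflects the half with `j < i` onto the half with `i < j`.
      ≡⟨ cong (∑[ i < v ] ∑[ j < v ] upper i j ℕ.+_) (∑-comm lower) ⟩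
    ∑[ i < v ] ∑[ j < v ] upper i j + ∑[ i < v ] ∑[ j < v ] lower j i
      ≡⟨ ∑-distrib-+ (λ i → sum (upper i)) (λ i → ∑[ j < v ] lower j i) ⟨
    ∑[ i < v ] (∑[ j < v ] upper i j + ∑[ j < v ] lower j i)
      ≡⟨ sum-cong-≗ (λ i → ∑-distrib-+ (upper i) (λ j → lower j i)) ⟨
    ∑[ i < v ] ∑[ j < v ] (upper i j + lower j i)
      ≤⟨ ∑-mono (λ i → ∑-mono (λ j → bound i j)) ⟩
    ∑[ i < v ] ∑[ j < v ] (c * ⟦ does (i <? j) ∧ adj G i j ⟧)
      ≡⟨ sum-cong-≗ (λ i → *-distribˡ-sum c (λ j → ⟦ does (i <? j) ∧ adj G i j ⟧)) ⟨
    ∑[ i < v ] (c * ∑[ j < v ] ⟦ does (i <? j) ∧ adj G i j ⟧)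
      ≡⟨ *-distribˡ-sum c (λ i → ∑[ j < v ] ⟦ does (i <? j) ∧ adj G i j ⟧) ⟨
    c * ∣E G ∣ ∎
    where
    open ≤-Reasoning
    upper lower : Fin v → Fin v → ℕ
    upper i j = ⟦ does (i <? j) ⟧ * f i j
    lower i j = ⟦ does (j <? i) ⟧ * f i j
    split : ∀ i j → f i j ≡ upper i j + lower i j
    split i j with <-cmp i j
    ... | tri< i<j _ j≮i rewrite dec-true (i <? j) i<j | dec-false (j <? i) j≮i =
      sym (trans (+-identityʳ _) (+-identityʳ _))
    ... | tri> i≮j _ j<i rewrite dec-false (i <? j) i≮j | dec-true (j <? i) j<i =
      sym (+-identityʳ _)
    ... | tri≈ _ refl _ rewrite diag i | *-zeroʳ ⟦ does (i <? i) ⟧ = refl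
    bound : ∀ i j → upper i j + lower j i ≤ c * ⟦ does (i <? j) ∧ adj G i j ⟧
    bound i j with does (i <? j)
    ... | true  = subst (_≤ c * ⟦ adj G i j ⟧)
      (sym (cong₂ _+_ (+-identityʳ (f i j)) (+-identityʳ (f j i)))) (pair i j)
    ... | false = z≤n

  ∑deg≤2∣E∣ : ∑[ x < v ] deg x ≤ 2 * ∣E G ∣
  ∑deg≤2∣E∣ = ∑∑≤edges 2 (λ x y → ⟦ adj G x y ⟧)
    (λ x → cong ⟦_⟧ (irrefl G x))
    (λ x y → ≤-reflexive (trans (cong (λ b → ⟦ adj G x y ⟧ + ⟦ b ⟧) (symm G y x))
      (cong (⟦ adj G x y ⟧ ℕ.+_) (sym (+-identityʳ _)))))

  -- Low and high vertices.

  module _ (D : ℕ) where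

    low : Fin v → Bool
    low x = does (deg x ≤? D)

    lowNbr highNbr : Fin v → Fin v → Bool
    lowNbr  x y = adj G x y ∧ low y
    highNbr x y = adj G x y ∧ not (low y)

    -- These are walks of length two through a low neighbour: at most `D` middle vertices because
    -- `x` is low, and at most `D` continuations because `y` is.
    ∑-lowNbr-deg : ∀ x → deg x ≤ D → ∑[ y < v ] ∑[ z < v ] ⟦ lowNbr x y ∧ adj G y z ⟧ ≤ D * D
    ∑-lowNbr-deg x deg≤D = begin
      ∑[ y < v ] ∑[ z < v ] ⟦ lowNbr x y ∧ adj G y z ⟧   ≤⟨ ∑-mono bound ⟩
      ∑[ y < v ] (⟦ adj G x y ⟧ * D)                     ≡⟨ *-distribʳ-sum D (λ y → ⟦ adj G x y ⟧) ⟨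
      deg x * D                                          ≤⟨ *-monoˡ-≤ D deg≤D ⟩
      D * D                                              ∎
      where
      open ≤-Reasoning
      bound : ∀ y → ∑[ z < v ] ⟦ lowNbr x y ∧ adj G y z ⟧ ≤ ⟦ adj G x y ⟧ * D
      bound y with adj G x y | low y in low-y
      ... | true  | true  = subst (deg y ≤_) (sym (+-identityʳ D)) (does-true (deg y ≤? D) low-y)
      ... | true  | false = ≤-trans (≤-reflexive (sum-replicate-zero v)) z≤n
      ... | false | _     = ≤-reflexive (sum-replicate-zero v)

    -- Counts, with multiplicity, the obstructions to using `z` as a column. A number rather than a
    -- truth value can be summed over `z` directly.
    conflict : Fin v → Fin v → ℕ
    conflict x z = ⟦ does (x ≟ z) ⟧ + ∑[ y < v ] ⟦ lowNbr x y ∧ adj G y z ⟧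

    column : Fin v → Fin v → Bool
    column x z = does (conflict x z ℕ.≟ 0)

    column⇒conflict≡0 : ∀ x z → column x z ≡ true → conflict x z ≡ 0
    column⇒conflict≡0 x z = does-true (conflict x z ℕ.≟ 0)

    column-≢ : ∀ x z → column x z ≡ true → x ≢ z
    column-≢ x z isCol x≡z = contradiction
      (trans (sym (cong ⟦_⟧ (dec-true (x ≟ z) x≡z))) (m+n≡0⇒m≡0 _ (column⇒conflict≡0 x z isCol))) λ ()

    column-low : ∀ x z → column x z ≡ true → ∀ y → lowNbr x y ≡ true → adj G y z ≡ false
    column-low x z isCol y low-y = ⟦b∧c⟧≤0 low-y
      (≤-trans (term≤∑ (λ y → ⟦ lowNbr x y ∧ adj G y z ⟧) y)
               (≤-reflexive (m+n≡0⇒n≡0 ⟦ does (x ≟ z) ⟧ (column⇒conflict≡0 x z isCol))))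
      where
      ⟦b∧c⟧≤0 : ∀ {b c} → b ≡ true → ⟦ b ∧ c ⟧ ≤ 0 → c ≡ false
      ⟦b∧c⟧≤0 {true} {false} _ _ = refl

    -- Every vertex that is not a column has a conflict, and the conflicts total at most
    -- `1 + D * D`: one for `x` itself, the rest for walks through low neighbours.
    v≤columns : ∀ x → deg x ≤ D → v ≤ count (column x) + (1 + D * D)
    v≤columns x deg≤D = begin
      v
        ≡⟨ trans (∑-const v 1) (*-identityʳ v) ⟨
      ∑[ z < v ] 1
        ≤⟨ ∑-mono (λ z → covered (conflict x z)) ⟩
      ∑[ z < v ] (⟦ column x z ⟧ + conflict x z)
        ≡⟨ ∑-distrib-+ (⟦_⟧ ∘ column x) (conflict x) ⟩
      count (column x) + sum (conflict x)
        ≡⟨ cong (count (column x) ℕ.+_) (∑-distrib-+ (λ z → ⟦ does (x ≟ z) ⟧) (λ z → ∑[ y < v ] ⟦ lowNbr x y ∧ adj G y z ⟧)) ⟩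
      count (column x) + (∑[ z < v ] ⟦ does (x ≟ z) ⟧ + ∑[ z < v ] ∑[ y < v ] ⟦ lowNbr x y ∧ adj G y z ⟧)
        ≡⟨ cong (count (column x) ℕ.+_) (cong₂ _+_ (∑-indicator x) (∑-comm (λ z y → ⟦ lowNbr x y ∧ adj G y z ⟧))) ⟩
      count (column x) + (1 + ∑[ y < v ] ∑[ z < v ] ⟦ lowNbr x y ∧ adj G y z ⟧)
        ≤⟨ +-monoʳ-≤ (count (column x)) (+-monoʳ-≤ 1 (∑-lowNbr-deg x deg≤D)) ⟩
      count (column x) + (1 + D * D) ∎
      where
      open ≤-Reasoning
      covered : ∀ s → 1 ≤ ⟦ does (s ℕ.≟ 0) ⟧ + s
      covered zero    = ≤-refl
      covered (suc s) = s≤s z≤n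

    -- On the chosen columns every low neighbour of x is a zero row, so a
    -- single zero row stands in for all of them.
    low-vertex⇒CA : ∀ {t k} → IsExistentiallyClosed (suc t) G → ∀ x → deg x ≤ D →
      k + (1 + D * D) ≤ v → CA (suc (count (highNbr x))) k t
    low-vertex⇒CA {t} {k} ec x deg≤D k≤ = M , covers
      where
      rows    = enumerate (highNbr x)
      columns = enumerate (column x)
      row : Fin (count (highNbr x)) → Fin v
      row = proj₁ rows
      k≤columns : k ≤ count (column x)
      k≤columns = +-cancelʳ-≤ (1 + D * D) k _ (≤-trans k≤ (v≤columns x deg≤D))
      -- Only `k` of the columns are kept; the application takes a power of two for `k`.
      col : Fin k → Fin v
      col i = proj₁ columns (inject≤ i k≤columns)
      col-inj : Injective _≡_ _≡_ col
      col-inj eq = inject≤-injective k≤columns k≤columns _ _ (proj₁ (proj₂ columns) eq)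
      col-column : ∀ i → column x (col i) ≡ true
      col-column i = proj₁ (proj₂ (proj₂ columns)) (inject≤ i k≤columns)
      M : Matrix (suc (count (highNbr x))) k
      M zero    i = false
      M (suc r) i = adj G (row r) (col i)
      covers : IsCoveringArray t M
      covers γ γ-inj w = find (adj G x y) (low y) refl refl
        where
        -- The vertex `x` joins the `t` columns with prescribed value `true`, which forces the
        -- witness to be a neighbour of `x`. This is why the strength is one less than the closure
        -- parameter.
        g : Fin (suc t) → Fin v
        g zero    = x
        g (suc j) = col (γ j)
        g-inj : Injective _≡_ _≡_ g
        g-inj {zero}  {zero}  eq = refl
        g-inj {zero}  {suc j} eq = contradiction eq (column-≢ x _ (col-column (γ j)))
        g-inj {suc i} {zero}  eq = contradiction (sym eq) (column-≢ x _ (col-column (γ i)))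
        g-inj {suc i} {suc j} eq = cong suc (γ-inj (col-inj eq))
        pattern′ : Fin (suc t) → Bool
        pattern′ zero    = true
        pattern′ (suc j) = w j
        witness = ec-witness g g-inj G ec pattern′
        y = proj₁ witness
        match = proj₂ witness
        find : ∀ a l → adj G x y ≡ a → low y ≡ l → ∃[ r ] (∀ j → M r (γ j) ≡ w j)
        find false _     x~y _   = contradiction (trans (sym x~y) (trans (symm G x y) (match zero))) λ ()
        find true  true  x~y low-y = zero , λ j →
          trans (sym (column-low x _ (col-column (γ j)) y (cong₂ _∧_ x~y low-y))) (match (suc j))
        find true  false x~y low-y =
          let r , row≡y = proj₂ (proj₂ (proj₂ rows)) y (cong₂ _∧_ x~y (cong not low-y))
          in suc r , λ j → trans (cong (λ u → adj G u (col (γ j))) row≡y) (match (suc j))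

    -- An edge is counted only from a low end whose other end is high, hence at most once. The
    -- charge per edge is 1, against 2 in the degree sum.
    ∑-low-highNbr≤∣E∣ : ∑[ x < v ] (⟦ low x ⟧ * count (highNbr x)) ≤ ∣E G ∣
    ∑-low-highNbr≤∣E∣ = begin
      ∑[ x < v ] (⟦ low x ⟧ * count (highNbr x))
        ≡⟨ sum-cong-≗ (λ x → *-distribˡ-sum ⟦ low x ⟧ (⟦_⟧ ∘ highNbr x)) ⟩
      ∑[ x < v ] ∑[ y < v ] (⟦ low x ⟧ * ⟦ highNbr x y ⟧)
        ≤⟨ ∑∑≤edges 1 (λ x y → ⟦ low x ⟧ * ⟦ highNbr x y ⟧) diag pair ⟩
      1 * ∣E G ∣
        ≡⟨ *-identityˡ ∣E G ∣ ⟩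
      ∣E G ∣ ∎
      where
      open ≤-Reasoning
      diag : ∀ x → ⟦ low x ⟧ * ⟦ highNbr x x ⟧ ≡ 0
      diag x rewrite irrefl G x = *-zeroʳ ⟦ low x ⟧
      pair : ∀ x y → ⟦ low x ⟧ * ⟦ highNbr x y ⟧ + ⟦ low y ⟧ * ⟦ highNbr y x ⟧ ≤ 1 * ⟦ adj G x y ⟧
      pair x y rewrite symm G y x with adj G x y | low x | low y
      ... | false | true  | true  = z≤n
      ... | false | true  | false = z≤n
      ... | false | false | true  = z≤n
      ... | false | false | false = z≤n
      ... | true  | true  | true  = z≤n
      ... | true  | true  | false = ≤-refl
      ... | true  | false | true  = ≤-refl
      ... | true  | false | false = z≤n

    -- Markov's inequality: each high vertex contributes more than `D` to the degree sum.
    high*D≤2∣E∣ : count (not ∘ low) * D ≤ 2 * ∣E G ∣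
    high*D≤2∣E∣ = begin
      count (not ∘ low) * D                ≡⟨ *-distribʳ-sum D (⟦_⟧ ∘ not ∘ low) ⟩
      ∑[ x < v ] (⟦ not (low x) ⟧ * D)     ≤⟨ ∑-mono bound ⟩
      ∑[ x < v ] deg x                     ≤⟨ ∑deg≤2∣E∣ ⟩
      2 * ∣E G ∣                           ∎
      where
      open ≤-Reasoning
      bound : ∀ x → ⟦ not (low x) ⟧ * D ≤ deg x
      bound x with low x in low-x
      ... | true  = z≤n
      ... | false = subst (_≤ deg x) (sym (+-identityʳ D))
                      (<⇒≤ (≰⇒> (does-false (deg x ≤? D) low-x)))

-- Asymptotics over ℕ

n<2^n : ∀ n → n < 2 ^ n
n<2^n zero    = ≤-refl
n<2^n (suc n) = begin-strict
  suc n            <⟨ s<s (n<2^n n) ⟩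
  1 + 2 ^ n        ≤⟨ +-mono-≤ (m^n>0 2 n) (≤-reflexive (sym (+-identityʳ (2 ^ n)))) ⟩
  2 ^ suc n        ∎
  where open ≤-Reasoning

linear≤2^ : ∀ C → ∃[ H ] (∀ h → H ≤ h → C * (2 + h) ≤ 2 ^ h)
-- With threshold `g + g` and `g = 2 * C`, the base case factors as `g * suc g`, and each factor is
-- at most `2 ^ g`.
linear≤2^ C = g + g , λ h H≤h → subst (λ h → C * (2 + h) ≤ 2 ^ h) (m∸n+n≡m H≤h) (go (h ∸ (g + g)))
  where
  open ≤-Reasoning
  g = 2 * C
  double : ∀ C g → C * (2 + (g + g)) ≡ (2 * C) * suc g
  double = solve-∀
  spread : ∀ C h → C * (2 + suc h) + C * (1 + h) ≡ 2 * (C * (2 + h))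
  spread = solve-∀
  go : ∀ d → C * (2 + (d + (g + g))) ≤ 2 ^ (d + (g + g))
  go zero = begin
    C * (2 + (g + g))   ≡⟨ double C g ⟩
    g * suc g           ≤⟨ *-mono-≤ (<⇒≤ (n<2^n g)) (n<2^n g) ⟩
    2 ^ g * 2 ^ g       ≡⟨ ^-distribˡ-+-* 2 g g ⟨
    2 ^ (g + g)         ∎
  go (suc d) = begin
    C * (2 + suc h)                 ≤⟨ m≤m+n _ _ ⟩
    C * (2 + suc h) + C * (1 + h)   ≡⟨ spread C h ⟩
    2 * (C * (2 + h))               ≤⟨ *-monoʳ-≤ 2 (go d) ⟩
    2 * 2 ^ h                       ∎
    where h = d + (g + g)

-- Either e is large already, or e ≤ avL makes the number H of high vertices
-- negligible.
absorb-errors : ∀ S a b C v e H D ℓ .{{_ : NonZero b}} .{{_ : NonZero D}} →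
  v * (a * suc ℓ) ≤ b * e + v * C + H * (a * suc ℓ) →
  H * D ≤ 2 * e →
  2 * (S * C) ≤ ℓ → 1 ≤ ℓ →
  8 * (S * (a * a)) * suc ℓ ≤ D →
  S * (a * (v * suc ℓ)) ≤ S * (b * e) + b * (v * ℓ)
absorb-errors S a b C v e H D ℓ count-bound HD≤2e 2SC≤ℓ 1≤ℓ poly≤D with ≤-total (a * (v * suc ℓ)) e
... | inj₁ large = begin
  S * (a * (v * suc ℓ))          ≤⟨ *-monoʳ-≤ S (≤-trans large (m≤n*m e b)) ⟩
  S * (b * e)                    ≤⟨ m≤m+n _ _ ⟩
  S * (b * e) + b * (v * ℓ)      ∎
  where open ≤-Reasoning
-- The claim is doubled because there are two errors, from `C` and from the high vertices; after
-- multiplication by `2 * S` each is at most `v * ℓ`.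
... | inj₂ small = *-cancelˡ-≤ 2 (begin
  2 * (S * (a * (v * L)))
    ≡⟨ r₁ S a v L ⟩
  2 * S * (v * (a * L))
    ≤⟨ *-monoʳ-≤ (2 * S) count-bound ⟩
  2 * S * (b * e + v * C + H * (a * L))
    ≡⟨ r₂ S b e v C (H * (a * L)) ⟩
  2 * (S * (b * e)) + v * (2 * (S * C)) + 2 * S * (H * (a * L))
    ≤⟨ +-mono-≤ (+-monoʳ-≤ (2 * (S * (b * e))) (*-monoʳ-≤ v 2SC≤ℓ)) high-error ⟩
  2 * (S * (b * e)) + v * ℓ + v * ℓ
    ≤⟨ +-mono-≤ (+-monoʳ-≤ (2 * (S * (b * e))) (m≤n*m (v * ℓ) b)) (m≤n*m (v * ℓ) b) ⟩
  2 * (S * (b * e)) + b * (v * ℓ) + b * (v * ℓ)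
    ≡⟨ r₃ (S * (b * e)) (b * (v * ℓ)) ⟩
  2 * (S * (b * e) + b * (v * ℓ)) ∎)
  where
  open ≤-Reasoning
  L = suc ℓ
  r₁ : ∀ S a v L → 2 * (S * (a * (v * L))) ≡ 2 * S * (v * (a * L))
  r₁ = solve-∀
  r₂ : ∀ S b e v C X → 2 * S * (b * e + v * C + X) ≡ 2 * (S * (b * e)) + v * (2 * (S * C)) + 2 * S * X
  r₂ = solve-∀
  r₃ : ∀ x y → 2 * x + y + y ≡ 2 * (x + y)
  r₃ = solve-∀
  r₄ : ∀ S H a L D → 2 * S * (H * (a * L)) * D ≡ 2 * (S * (a * L)) * (H * D)
  r₄ = solve-∀
  r₅ : ∀ S a v L → 2 * (S * (a * L)) * (2 * (a * (v * L))) ≡ 4 * (S * (a * a)) * L * (v * L)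
  r₅ = solve-∀
  r₆ : ∀ X v ℓ L → 4 * X * L * (v * (ℓ + ℓ)) ≡ 8 * X * L * (v * ℓ)
  r₆ = solve-∀
  -- Multiplying by `D` allows `H * D` to be replaced by `2 * e`, hence by a multiple of `v * L`.
  -- With `L ≤ ℓ + ℓ`, the remaining factor is below `D` by `poly≤D`.
  high-error : 2 * S * (H * (a * L)) ≤ v * ℓ
  high-error = *-cancelʳ-≤ _ _ D (begin
    2 * S * (H * (a * L)) * D
      ≡⟨ r₄ S H a L D ⟩
    2 * (S * (a * L)) * (H * D)
      ≤⟨ *-monoʳ-≤ (2 * (S * (a * L))) (≤-trans HD≤2e (*-monoʳ-≤ 2 small)) ⟩
    2 * (S * (a * L)) * (2 * (a * (v * L)))
      ≡⟨ r₅ S a v L ⟩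
    4 * (S * (a * a)) * L * (v * L)
      ≤⟨ *-monoʳ-≤ (4 * (S * (a * a)) * L) (*-monoʳ-≤ v (+-monoˡ-≤ ℓ 1≤ℓ)) ⟩
    4 * (S * (a * a)) * L * (v * (ℓ + ℓ))
      ≡⟨ r₆ (S * (a * a)) v ℓ L ⟩
    8 * (S * (a * a)) * L * (v * ℓ)
      ≤⟨ *-monoˡ-≤ (v * ℓ) poly≤D ⟩
    D * (v * ℓ)
      ≡⟨ *-comm D (v * ℓ) ⟩
    v * ℓ * D ∎)

-- The edge bound in natural numbers.

module _ {v t} (G : Graph v) (ec : IsExistentiallyClosed (suc t) G) where

  -- Each vertex is to pay `a * (3 + j)`, where `3 + j` will be `suc ⌊log₂ v ⌋`. Low vertices pay
  -- through their high neighbours, up to a constant; high vertices are written off in full.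
  CA-bound⇒edges : ∀ a b D j →
    (∀ N → CA N (2 ^ j) t → a * j ≤ b * suc N) →
    2 ^ j + (1 + D * D) ≤ v →
    v * (a * (3 + j)) ≤ b * ∣E G ∣ + v * (2 * b + 3 * a) + count (not ∘ low G D) * (a * (3 + j))
  CA-bound⇒edges a b D j bound k≤ = begin
    v * X
      ≡⟨ cong (_* X) (count+count-not≡n (low G D)) ⟨
    (count (low G D) + #high) * X
      ≡⟨ *-distribʳ-+ X (count (low G D)) #high ⟩
    count (low G D) * X + #high * X
      ≡⟨ cong (_+ #high * X) (*-distribʳ-sum X (⟦_⟧ ∘ low G D)) ⟩
    ∑[ x < v ] (⟦ low G D x ⟧ * X) + #high * X
      ≤⟨ +-monoˡ-≤ (#high * X) (∑-mono pointwise) ⟩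
    ∑[ x < v ] (b * (⟦ low G D x ⟧ * degH x) + C) + #high * X
      ≡⟨ cong (_+ #high * X) (∑-distrib-+ (λ x → b * (⟦ low G D x ⟧ * degH x)) (λ _ → C)) ⟩
    ∑[ x < v ] (b * (⟦ low G D x ⟧ * degH x)) + ∑[ x < v ] C + #high * X
      ≡⟨ cong (_+ #high * X) (cong₂ _+_ (sym (*-distribˡ-sum b (λ x → ⟦ low G D x ⟧ * degH x))) (∑-const v C)) ⟩
    b * ∑[ x < v ] (⟦ low G D x ⟧ * degH x) + v * C + #high * X
      ≤⟨ +-monoˡ-≤ (#high * X) (+-monoˡ-≤ (v * C) (*-monoʳ-≤ b (∑-low-highNbr≤∣E∣ G D))) ⟩
    b * ∣E G ∣ + v * C + #high * X ∎
    where
    open ≤-Reasoning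
    X C #high : ℕ
    X = a * (3 + j)
    -- The part `2 * b` pays for the zero row and for the `suc N` in the hypothesis; `3 * a` pays
    -- for the difference between `j` and `3 + j`.
    C = 2 * b + 3 * a
    #high = count (not ∘ low G D)
    degH : Fin v → ℕ
    degH x = count (highNbr G D x)
    expand : ∀ a b d → b * suc (suc d) + 3 * a ≡ b * (1 * d) + (2 * b + 3 * a)
    expand = solve-∀
    peel : ∀ a j → 1 * (a * (3 + j)) ≡ a * j + 3 * a
    peel = solve-∀
    pointwise : ∀ x → ⟦ low G D x ⟧ * X ≤ b * (⟦ low G D x ⟧ * degH x) + C
    pointwise x with low G D x in low-x
    ... | false = z≤n
    ... | true  = begin
      1 * X
        ≡⟨ peel a j ⟩
      a * j + 3 * a
        ≤⟨ +-monoˡ-≤ (3 * a) (bound _ (low-vertex⇒CA G D ec x (does-true (deg G x ≤? D) low-x) k≤)) ⟩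
      b * suc (suc (degH x)) + 3 * a
        ≡⟨ expand a b (degH x) ⟩
      b * (1 * degH x) + C ∎

-- For positive `S`, division by `S * b` shows the meaning: `a / b` stands for a rational just below
-- the covering array constant and `1 / S` for the relative error. The rounding `suc ⌊log₂ v ⌋`
-- against `⌊log₂ v ⌋` makes both sides safe to compare with the true logarithm.
edges-bound : ∀ t a b S J .{{_ : NonZero b}} →
  (∀ j N → J ≤ j → CA N (2 ^ j) t → a * j ≤ b * suc N) →
  ∃[ V ] (∀ v → V ≤ v → (G : Graph v) → IsExistentiallyClosed (suc t) G →
    S * (a * (v * suc ⌊log₂ v ⌋)) ≤ S * (b * ∣E G ∣) + b * (v * ⌊log₂ v ⌋))
edges-bound t a b S J bound = 2 ^ (2 + j₀) , result
  where
  open ≤-Reasoning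
  P C h₀ j₀ : ℕ
  -- The factor doubles from 8 to 16 because `3 + j ≤ 2 * (2 + h)`.
  P  = 16 * (S * (a * a))
  C  = 2 * b + 3 * a
  h₀ = proj₁ (linear≤2^ P)
  -- The summands ensure, in order, that the covering array bound applies, that `h₀ ≤ h`, and that
  -- `2 * (S * C) ≤ ℓ`.
  j₀ = J + (h₀ + h₀) + 2 * (S * C)
  result : ∀ v → 2 ^ (2 + j₀) ≤ v → (G : Graph v) → IsExistentiallyClosed (suc t) G →
    S * (a * (v * suc ⌊log₂ v ⌋)) ≤ S * (b * ∣E G ∣) + b * (v * ⌊log₂ v ⌋)
  result v V≤v G ec = subst (λ ℓ → S * (a * (v * suc ℓ)) ≤ S * (b * ∣E G ∣) + b * (v * ℓ)) 2+j≡ℓ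
    (absorb-errors S a b C v ∣E G ∣ (count (not ∘ low G D)) D (2 + j)
      (CA-bound⇒edges G ec a b D j (λ N → bound j N (≤-trans J≤j₀ j₀≤j)) k≤v)
      (high*D≤2∣E∣ G D)
      (≤-trans (m≤n+m (2 * (S * C)) (J + (h₀ + h₀))) (≤-trans j₀≤j (m≤n+m j 2)))
      (s≤s z≤n)
      poly≤D)
    where
    ℓ j h D : ℕ
    ℓ = ⌊log₂ v ⌋
    -- With these choices `D * D ≤ 2 ^ j`, so columns and exclusions together need at most
    -- `3 * 2 ^ j ≤ 2 ^ ℓ ≤ v` vertices, while `D` still outgrows every multiple of `ℓ`.
    j = ℓ ∸ 2
    h = ⌊ j /2⌋
    D = 2 ^ h
    instance
      D≢0 : NonZero D
      D≢0 = m^n≢0 2 h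
    2+j₀≤ℓ : 2 + j₀ ≤ ℓ
    2+j₀≤ℓ = subst (_≤ ℓ) (⌊log₂[2^n]⌋≡n (2 + j₀)) (⌊log₂⌋-mono-≤ V≤v)
    2+j≡ℓ : 2 + j ≡ ℓ
    2+j≡ℓ = m+[n∸m]≡n (≤-trans (m≤m+n 2 j₀) 2+j₀≤ℓ)
    j₀≤j : j₀ ≤ j
    j₀≤j = +-cancelˡ-≤ 2 j₀ j (≤-trans 2+j₀≤ℓ (≤-reflexive (sym 2+j≡ℓ)))
    J≤j₀ : J ≤ j₀
    J≤j₀ = ≤-trans (m≤m+n J _) (m≤m+n _ _)
    h₀≤h : h₀ ≤ h
    h₀≤h = subst (_≤ h) (sym (n≡⌊n+n/2⌋ h₀))
      (⌊n/2⌋-mono (≤-trans (m≤n+m _ J) (≤-trans (m≤m+n _ _) j₀≤j)))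
    h+h≤j : h + h ≤ j
    h+h≤j = ≤-trans (+-monoʳ-≤ h (⌊n/2⌋≤⌈n/2⌉ j)) (≤-reflexive (⌊n/2⌋+⌈n/2⌉≡n j))
    j≤1+h+h : j ≤ suc (h + h)
    j≤1+h+h = begin
      j                  ≡⟨ ⌊n/2⌋+⌈n/2⌉≡n j ⟨
      h + ⌊ suc j /2⌋    ≤⟨ +-monoʳ-≤ h (⌊n/2⌋-mono {suc j} {2 + j} (n≤1+n (suc j))) ⟩
      h + suc h          ≡⟨ +-suc h h ⟩
      suc (h + h)        ∎
    regroup : ∀ X h → 8 * X * (4 + (h + h)) ≡ 16 * X * (2 + h)
    regroup = solve-∀
    poly≤D : 8 * (S * (a * a)) * (3 + j) ≤ D
    poly≤D = begin
      8 * (S * (a * a)) * (3 + j)         ≤⟨ *-monoʳ-≤ (8 * (S * (a * a))) (+-monoʳ-≤ 3 j≤1+h+h) ⟩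
      8 * (S * (a * a)) * (4 + (h + h))   ≡⟨ regroup (S * (a * a)) h ⟩
      P * (2 + h)                         ≤⟨ proj₂ (linear≤2^ P) h h₀≤h ⟩
      D                                   ∎
    four : ∀ x → x + (x + x) ≤ 2 * (2 * x)
    four x = subst (x + (x + x) ≤_) (r x) (m≤m+n _ x)
      where
      r : ∀ x → x + (x + x) + x ≡ 2 * (2 * x)
      r = solve-∀
    0<v : 0 < v
    0<v = ≤-trans (m^n>0 2 (2 + j₀)) V≤v
    k≤v : 2 ^ j + (1 + D * D) ≤ v
    k≤v = begin
      2 ^ j + (1 + D * D)         ≡⟨ cong (λ x → 2 ^ j + (1 + x)) (^-distribˡ-+-* 2 h h) ⟨
      2 ^ j + (1 + 2 ^ (h + h))   ≤⟨ +-monoʳ-≤ (2 ^ j) (+-mono-≤ (m^n>0 2 j) (^-monoʳ-≤ 2 h+h≤j)) ⟩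
      2 ^ j + (2 ^ j + 2 ^ j)     ≤⟨ four (2 ^ j) ⟩
      2 ^ (2 + j)                 ≡⟨ cong (2 ^_) 2+j≡ℓ ⟩
      2 ^ ℓ                       ≤⟨ 2^⌊log₂n⌋≤n v {{>-nonZero 0<v}} ⟩
      v                           ∎

-- Passage to the reals

module Diagonal (W : ℕ → ℕ) where

  advance : ℕ → ℕ → ℕ
  advance m v with W (suc m) ≤? v
  ... | yes _ = suc m
  ... | no  _ = m

  -- The argument counts time from `W 0`, when precision 0 becomes available. Precision rises by at
  -- most one per unit of time, once the next threshold has passed.
  index : ℕ → ℕ
  index zero    = 0
  index (suc d) = advance (index d) (W 0 + suc d)

  advance-≥ : ∀ m v → m ≤ advance m v
  advance-≥ m v with W (suc m) ≤? v
  ... | yes _ = n≤1+n m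
  ... | no  _ = ≤-refl

  W-index≤ : ∀ d → W (index d) ≤ W 0 + d
  W-index≤ zero    = m≤m+n (W 0) 0
  W-index≤ (suc d) with W (suc (index d)) ≤? W 0 + suc d
  ... | yes le = le
  ... | no  _  = ≤-trans (W-index≤ d) (+-monoʳ-≤ (W 0) (n≤1+n d))

  index-mono : ∀ {d e} → d ≤ e → index d ≤ index e
  index-mono {e = zero}  z≤n = ≤-refl
  index-mono {d} {suc e} d≤e with m≤n⇒m<n∨m≡n d≤e
  ... | inj₁ (s≤s d≤e′) = ≤-trans (index-mono d≤e′) (advance-≥ (index e) (W 0 + suc e))
  ... | inj₂ refl       = ≤-refl

  advance-reaches : ∀ {m x v} → W (suc m) ≤ v → m ≤ x → suc m ≤ advance x v
  advance-reaches {m} {x} {v} W≤v m≤x with m≤n⇒m<n∨m≡n m≤x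
  ... | inj₁ m<x = ≤-trans m<x (advance-≥ x v)
  ... | inj₂ refl with W (suc x) ≤? v
  ...   | yes _  = ≤-refl
  ...   | no W≰v = contradiction W≤v W≰v

  index-reaches : ∀ m → ∃[ d ] m ≤ index d
  index-reaches zero    = 0 , z≤n
  index-reaches (suc m) =
    let d₀ , m≤ = index-reaches m
        d = d₀ + W (suc m)
    in suc d , advance-reaches
         (≤-trans (m≤n+m (W (suc m)) d₀) (≤-trans (n≤1+n d) (m≤n+m (suc d) (W 0))))
         (≤-trans m≤ (index-mono (m≤m+n d₀ (W (suc m)))))

  index-→∞ : ∀ m → ∃[ D ] (∀ d → D ≤ d → m ≤ index d)
  index-→∞ m = let D , m≤ = index-reaches m in D , λ d D≤d → ≤-trans m≤ (index-mono D≤d)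

-- Merges bounds that hold eventually at each fixed precision into one whose precision tends to
-- infinity with `v`; this produces the single `o(1)` function.
diagonalise : (P : ℕ → ℕ → Set) → (∀ s → ∃[ V ] (∀ v → V ≤ v → P s v)) →
  ∃[ f ] ((∀ m → ∃[ K ] (∀ k → K ≤ k → m ≤ f k)) ×
  ∃[ V ] (∀ v → V ≤ v → P (f v) v))
diagonalise P eventually = slow , slow→∞ , W 0 , λ v W₀≤v →
  proj₂ (eventually (slow v)) v
    (≤-trans (W-index≤ (v ∸ W 0)) (≤-reflexive (m+[n∸m]≡n W₀≤v)))
  where
  W : ℕ → ℕ
  W s = proj₁ (eventually s)
  open Diagonal W
  slow : ℕ → ℕ
  slow v = index (v ∸ W 0)
  slow→∞ : ∀ m → ∃[ K ] (∀ k → K ≤ k → m ≤ slow k)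
  slow→∞ m = let D , m≤ = index-→∞ m in W 0 + D , λ k le →
    m≤ (k ∸ W 0) (m+n≤o⇒m≤o∸n D (subst (_≤ k) (+-comm (W 0) D) le))

-- Fractions of naturals and approximations of logarithms.

/-* : ∀ a m b → (+ a / suc m) ℚ.* (+ b / 1) ≡ + (a * b) / suc m
/-* a m b = ℚ.toℚᵘ-injective (begin
  ℚ.toℚᵘ ((+ a / suc m) ℚ.* (+ b / 1))
    ≈⟨ ℚ.toℚᵘ-homo-* (+ a / suc m) (+ b / 1) ⟩
  ℚ.toℚᵘ (+ a / suc m) ℚᵘ.* ℚ.toℚᵘ (+ b / 1)
    ≈⟨ ℚᵘ.*-cong (ℚ.toℚᵘ-fromℚᵘ (mkℚᵘ (+ a) m)) (ℚ.toℚᵘ-fromℚᵘ (mkℚᵘ (+ b) 0)) ⟩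
  mkℚᵘ (+ a) m ℚᵘ.* mkℚᵘ (+ b) 0
    ≈⟨ ℚᵘ.*≡* (cong₂ ℤ._*_ (sym (ℤ.pos-* a b)) (cong (+_) (sym (*-identityʳ (suc m))))) ⟩
  mkℚᵘ (+ (a * b)) m
    ≈⟨ ℚ.toℚᵘ-fromℚᵘ (mkℚᵘ (+ (a * b)) m) ⟨
  ℚ.toℚᵘ (+ (a * b) / suc m) ∎)
  where open import Relation.Binary.Reasoning.Setoid ℚᵘ.≃-setoid

/-+ : ∀ a c n → + (a + c) / suc n ≡ + a / suc n ℚ.+ + c / suc n
/-+ a c n = ℚ.toℚᵘ-injective (begin
  ℚ.toℚᵘ (+ (a + c) / suc n)
    ≈⟨ ℚ.toℚᵘ-fromℚᵘ (mkℚᵘ (+ (a + c)) n) ⟩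
  mkℚᵘ (+ (a + c)) n
    ≈⟨ ℚᵘ.*≡* cross ⟩
  mkℚᵘ (+ a) n ℚᵘ.+ mkℚᵘ (+ c) n
    ≈⟨ ℚᵘ.+-cong (ℚ.toℚᵘ-fromℚᵘ (mkℚᵘ (+ a) n)) (ℚ.toℚᵘ-fromℚᵘ (mkℚᵘ (+ c) n)) ⟨
  ℚ.toℚᵘ (+ a / suc n) ℚᵘ.+ ℚ.toℚᵘ (+ c / suc n)
    ≈⟨ ℚ.toℚᵘ-homo-+ (+ a / suc n) (+ c / suc n) ⟨
  ℚ.toℚᵘ (+ a / suc n ℚ.+ + c / suc n) ∎)
  where
  open import Relation.Binary.Reasoning.Setoid ℚᵘ.≃-setoid
  d = + suc n
  cross : + (a + c) ℤ.* (d ℤ.* d) ≡ (+ a ℤ.* d ℤ.+ + c ℤ.* d) ℤ.* d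
  cross = trans (sym (ℤ.*-assoc (+ a ℤ.+ + c) d d))
                (cong (ℤ._* d) (ℤ.*-distribʳ-+ d (+ a) (+ c)))

/-cancel-≤ : ∀ a b m n → + a / suc m ℚ.≤ + b / suc n → a * suc n ≤ b * suc m
/-cancel-≤ a b m n le = ℤ.drop‿+≤+
  (subst₂ ℤ._≤_ (sym (ℤ.pos-* a (suc n))) (sym (ℤ.pos-* b (suc m))) (ℚᵘ.drop-*≤* le′))
  where
  open ℚᵘ.≤-Reasoning
  le′ : mkℚᵘ (+ a) m ℚᵘ.≤ mkℚᵘ (+ b) n
  le′ = begin
    mkℚᵘ (+ a) m          ≃⟨ ℚ.toℚᵘ-fromℚᵘ (mkℚᵘ (+ a) m) ⟨
    ℚ.toℚᵘ (+ a / suc m)  ≤⟨ ℚ.toℚᵘ-mono-≤ le ⟩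
    ℚ.toℚᵘ (+ b / suc n)  ≃⟨ ℚ.toℚᵘ-fromℚᵘ (mkℚᵘ (+ b) n) ⟩
    mkℚᵘ (+ b) n          ∎

/-nonNeg : ∀ a m → ℚ.NonNegative (+ a / suc m)
/-nonNeg a m = ℚ.nonNegative (/-mono-≤ 0 a 0 m z≤n)

-- A negative bound is replaced by 0, where the inequality to be derived is trivial; the numerator
-- can then be a natural number.
positivePart : ∀ p → ∃[ a ] ∃[ b ] (p ℚ.≤ + a / suc b × (a ≡ 0 ⊎ p ≡ + a / suc b))
positivePart p@(mkℚ (+ a) b _) = a , b , ℚ.≤-reflexive p≡ , inj₂ p≡
  where
  p≡ : p ≡ + a / suc b
  p≡ = sym (ℚ.fromℚᵘ-toℚᵘ p)
positivePart p@(mkℚ ℤ.-[1+ a ] b _) = 0 , 0 , ℚ.nonPositive⁻¹ p , inj₁ refl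

∣p-q∣≤ε⇒p≤q+ε : ∀ p q {ε} → ℚ.∣ p ℚ.- q ∣ ℚ.≤ ε → p ℚ.≤ q ℚ.+ ε
∣p-q∣≤ε⇒p≤q+ε p q {ε} close = begin
  p                          ≡⟨ split p q ⟩
  q ℚ.+ (p ℚ.- q)            ≤⟨ ℚ.+-monoʳ-≤ q (ℚ.≤-trans (p≤∣p∣ (p ℚ.- q)) close) ⟩
  q ℚ.+ ε                    ∎
  where
  open ℚ.≤-Reasoning
  open +-*-Solver
  split : ∀ p q → p ≡ q ℚ.+ (p ℚ.- q)
  split = solve 2 (λ p q → p := q :+ (p :- q)) refl
  p≤∣p∣ : ∀ p → p ℚ.≤ ℚ.∣ p ∣
  p≤∣p∣ (mkℚ (+ _) _ _)        = ℚ.≤-refl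
  p≤∣p∣ p@(mkℚ ℤ.-[1+ _ ] _ _) = ℚ.≤-trans (ℚ.nonPositive⁻¹ p) (ℚ.0≤∣p∣ p)

p≤p+ε : ∀ {p ε} → 0ℚ ℚ.< ε → p ℚ.≤ p ℚ.+ ε
p≤p+ε {p} {ε} ε>0 = subst (ℚ._≤ p ℚ.+ ε) (ℚ.+-identityʳ p) (ℚ.+-monoʳ-≤ p (ℚ.<⇒≤ ε>0))

seq-log₂ : ∀ k m → .{{_ : ℕ.NonZero k}} → seq (log₂ k) m ≡ log₂-seq k m
seq-log₂ (suc k) m = refl

-- This is the benefit of a power of two columns: every approximation of the logarithm is exact.
log₂-seq-2^ : ∀ j m → log₂-seq (2 ^ j) m ≡ + j / 1
log₂-seq-2^ j m = ℚ.≤-antisym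
  (/-mono-≤ ⌊log₂ ((2 ^ j) ^ suc m) ⌋ j m 0 (≤-reflexive (trans (*-identityʳ _) log≡)))
  (/-mono-≤ j ⌊log₂ ((2 ^ j) ^ suc m) ⌋ 0 m (≤-reflexive (trans (sym log≡) (sym (*-identityʳ _)))))
  where
  log≡ : ⌊log₂ ((2 ^ j) ^ suc m) ⌋ ≡ j * suc m
  log≡ = trans (cong ⌊log₂_⌋ (^-*-assoc 2 j (suc m))) (⌊log₂[2^n]⌋≡n (j * suc m))

-- Comparison with the term of index 0, which is the floor itself and is off by at most 1.
log₂-seq-≤-suc-floor : ∀ k m → .{{_ : ℕ.NonZero k}} → log₂-seq k m ℚ.≤ + suc ⌊log₂ k ⌋ / 1
log₂-seq-≤-suc-floor k m = begin
  log₂-seq k m                           ≤⟨ log₂-seq-≤ k m 0 ⟩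
  + ⌊log₂ (k ^ 1) ⌋ / 1 ℚ.+ + 1 / 1      ≡⟨ suc-/ ⌊log₂ (k ^ 1) ⌋ 0 ⟨
  + suc ⌊log₂ (k ^ 1) ⌋ / 1              ≡⟨ cong (λ k → + suc ⌊log₂ k ⌋ / 1) (*-identityʳ k) ⟩
  + suc ⌊log₂ k ⌋ / 1                    ∎
  where open ℚ.≤-Reasoning

floor-≤-log₂-seq : ∀ k m → .{{_ : ℕ.NonZero k}} → + ⌊log₂ k ⌋ / 1 ℚ.≤ log₂-seq k m
floor-≤-log₂-seq k m = /-mono-≤ ⌊log₂ k ⌋ ⌊log₂ (k ^ suc m) ⌋ 0 m (begin
  ℓ * suc m                      ≡⟨ ⌊log₂[2^n]⌋≡n (ℓ * suc m) ⟨
  ⌊log₂ (2 ^ (ℓ * suc m)) ⌋      ≡⟨ cong ⌊log₂_⌋ (^-*-assoc 2 ℓ (suc m)) ⟨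
  ⌊log₂ ((2 ^ ℓ) ^ suc m) ⌋      ≤⟨ ⌊log₂⌋-mono-≤ (^-monoˡ-≤ (suc m) (2^⌊log₂n⌋≤n k)) ⟩
  ⌊log₂ (k ^ suc m) ⌋            ≡⟨ *-identityʳ _ ⟨
  ⌊log₂ (k ^ suc m) ⌋ * 1        ∎)
  where
  open ≤-Reasoning
  ℓ = ⌊log₂ k ⌋

-- 1 + N rather than N: the hypothesis N ≥ℝ … is used with an error of 1.
RationalLowerBound : ℕ → ℝ → ℚ → Set
RationalLowerBound t c gap =
  ∃[ a ] ∃[ b ] ∃[ J ]
    ((∀ j N → J ≤ j → CA N (2 ^ j) t → a * j ≤ suc b * suc N) ×
     ∃[ M ] (∀ m → M ≤ m → seq c m ℚ.≤ + a / suc b ℚ.+ gap))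

-- The real bound must become an integer inequality, so `c` is replaced by a fixed rational below
-- it, and `gap` records the loss.
rationalLowerBound : ∀ t c η → 0ℚ ℚ.< η → CoveringArrayBound t c →
  RationalLowerBound t c (η ℚ.+ η ℚ.+ (η ℚ.+ η))
rationalLowerBound t c η η>0 (δ , δ→0 , K , bound) =
  a , b , K ⊔ K₂ , nat-bound (proj₂ (proj₂ (proj₂ pos))) , M , λ m M≤m → begin
    seq c m                                    ≤⟨ ∣p-q∣≤ε⇒p≤q+ε (seq c m) q (proj₂ near m M M≤m ≤-refl) ⟩
    q ℚ.+ η                                    ≡⟨ shift q η ⟩
    p ℚ.+ (η ℚ.+ η ℚ.+ (η ℚ.+ η))              ≤⟨ ℚ.+-monoˡ-≤ _ (proj₁ (proj₂ (proj₂ pos))) ⟩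
    + a / suc b ℚ.+ (η ℚ.+ η ℚ.+ (η ℚ.+ η))    ∎
  where
  open ℚ.≤-Reasoning
  near = cauchy c η η>0
  M = proj₁ near
  q p : ℚ
  q = seq c M
  -- One `η` covers the distance from `q` to later terms of `c`, one the size of `δ`, and one the
  -- tolerance in `≤ℝ`. Returning from `q` to `seq c m` costs a fourth.
  p = q ℚ.- (η ℚ.+ η ℚ.+ η)
  pos = positivePart p
  a = proj₁ pos
  b = proj₁ (proj₂ pos)
  K₂ = proj₁ (δ→0 η η>0)
  shift : ∀ q η → q ℚ.+ η ≡ q ℚ.- (η ℚ.+ η ℚ.+ η) ℚ.+ (η ℚ.+ η ℚ.+ (η ℚ.+ η))
  shift = solve 2 (λ q η → q :+ η := q :- (η :+ η :+ η) :+ (η :+ η :+ (η :+ η))) refl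
    where open +-*-Solver
  regroup : ∀ c η → c ℚ.+ η ℚ.- (η ℚ.+ η ℚ.+ η) ≡ c ℚ.+ (ℚ.- η ℚ.- η)
  regroup = solve 2 (λ c η → c :+ η :- (η :+ η :+ η) := c :+ (:- η :- η)) refl
    where open +-*-Solver
  cancel : ∀ d η → d ℚ.+ η ℚ.- η ≡ d
  cancel = solve 2 (λ d η → d :+ η :- η := d) refl
    where open +-*-Solver
  nat-bound : a ≡ 0 ⊎ p ≡ + a / suc b →
    ∀ j N → K ⊔ K₂ ≤ j → CA N (2 ^ j) t → a * j ≤ suc b * suc N
  nat-bound (inj₁ a≡0) j N _ _ = subst (λ a → a * j ≤ suc b * suc N) (sym a≡0) z≤n
  nat-bound (inj₂ p≡)  j N K≤j ca = subst₂ _≤_ (*-identityʳ (a * j)) (*-comm (suc N) (suc b))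
    (/-cancel-≤ (a * j) (suc N) b 0 (begin
      + (a * j) / suc b
        ≡⟨ /-* a b j ⟨
      (+ a / suc b) ℚ.* (+ j / 1)
        ≡⟨ cong (ℚ._* (+ j / 1)) p≡ ⟨
      p ℚ.* (+ j / 1)
        ≤⟨ ℚ.*-monoʳ-≤-nonNeg (+ j / 1) {{/-nonNeg j 0}} p≤ ⟩
      (seq c m ℚ.+ seq (δ k) m) ℚ.* (+ j / 1)
        ≡⟨ cong ((seq c m ℚ.+ seq (δ k) m) ℚ.*_) (trans (seq-log₂ k m {{m^n≢0 2 j}}) (log₂-seq-2^ j m)) ⟨
      (seq c m ℚ.+ seq (δ k) m) ℚ.* seq (log₂ k) m
        ≤⟨ proj₂ N-bound m (≤-trans (m≤n⊔m M _) (m≤m⊔n _ _)) ⟩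
      + N / 1 ℚ.+ 1ℚ
        ≡⟨ suc-/ N 0 ⟨
      + suc N / 1 ∎))
    where
    k = 2 ^ j
    -- Thresholds stated for `k = 2 ^ j` thus hold already when `j` exceeds them.
    j≤k : j ≤ k
    j≤k = <⇒≤ (n<2^n j)
    N-bound = bound k N (≤-trans (m⊔n≤o⇒m≤o K K₂ K≤j) j≤k) ca 1ℚ (ℚ.positive⁻¹ 1ℚ)
    δ-bound = proj₁ (proj₂ (δ→0 η η>0) k (≤-trans (m⊔n≤o⇒n≤o K K₂ K≤j) j≤k)) η η>0
    -- One index late enough for all three sequences, so that the rest is arithmetic in the
    -- rationals.
    m = M ⊔ proj₁ N-bound ⊔ proj₁ δ-bound
    -2η≤δ : ℚ.- η ℚ.- η ℚ.≤ seq (δ k) m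
    -2η≤δ = subst (ℚ.- η ℚ.- η ℚ.≤_) (cancel _ η)
      (ℚ.+-monoˡ-≤ (ℚ.- η) (proj₂ δ-bound m (m≤n⊔m _ _)))
    p≤ : p ℚ.≤ seq c m ℚ.+ seq (δ k) m
    p≤ = begin
      q ℚ.- (η ℚ.+ η ℚ.+ η)
        ≤⟨ ℚ.+-monoˡ-≤ (ℚ.- (η ℚ.+ η ℚ.+ η)) (∣p-q∣≤ε⇒p≤q+ε q (seq c m)
             (proj₂ near M m ≤-refl (≤-trans (m≤m⊔n M _) (m≤m⊔n _ _)))) ⟩
      seq c m ℚ.+ η ℚ.- (η ℚ.+ η ℚ.+ η)
        ≡⟨ regroup (seq c m) η ⟩
      seq c m ℚ.+ (ℚ.- η ℚ.- η)
        ≤⟨ ℚ.+-monoʳ-≤ (seq c m) -2η≤δ ⟩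
      seq c m ℚ.+ seq (δ k) m ∎

-- The edge bound with a fixed error.

slack : ℕ → ℚ
slack s = (+ 5 / 1) ℚ.* (+ 1 / suc s)

-- Of the five units in `slack`, four cover the gap of the rational lower bound and one the error
-- `1 / S` of `edges-bound` with `S = suc s`.
slack-absorbs : ∀ c r s → let η = + 1 / suc s in
  c ℚ.≤ r ℚ.+ (η ℚ.+ η ℚ.+ (η ℚ.+ η)) → c ℚ.- slack s ℚ.≤ r ℚ.- η
slack-absorbs c r s c≤ = subst (c ℚ.- slack s ℚ.≤_) (cancel r (+ 1 / suc s)) (ℚ.+-monoˡ-≤ (ℚ.- slack s) c≤)
  where
  cancel : ∀ r η → r ℚ.+ (η ℚ.+ η ℚ.+ (η ℚ.+ η)) ℚ.- (+ 5 / 1) ℚ.* η ≡ r ℚ.- η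
  cancel = solve 2 (λ r η → r :+ (η :+ η :+ (η :+ η)) :- con (+ 5 / 1) :* η := r :- η) refl
    where open +-*-Solver

-- The logarithm is rounded up where it multiplies `r` and down where it multiplies `η`, so both
-- roundings go in the favourable direction.
rational-edges-bound : ∀ a b s v e lg → let ℓ = ⌊log₂ v ⌋ in
  suc s * (a * (v * suc ℓ)) ≤ suc s * (suc b * e) + suc b * (v * ℓ) →
  + ℓ / 1 ℚ.≤ lg → lg ℚ.≤ + suc ℓ / 1 →
  (+ a / suc b ℚ.- + 1 / suc s) ℚ.* ((+ v / 1) ℚ.* lg) ℚ.≤ + e / 1
rational-edges-bound a b s v e lg nat ℓ≤lg lg≤1+ℓ = begin
  (r ℚ.- η) ℚ.* w                                 ≡⟨ expand r η w ⟩
  r ℚ.* w ℚ.- η ℚ.* w                             ≤⟨ ℚ.+-monoˡ-≤ (ℚ.- (η ℚ.* w)) rw≤ ⟩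
  + e / 1 ℚ.+ η ℚ.* w ℚ.- η ℚ.* w                 ≡⟨ cancel (+ e / 1) (η ℚ.* w) ⟩
  + e / 1                                         ∎
  where
  open ℚ.≤-Reasoning
  ℓ = ⌊log₂ v ⌋
  r η w : ℚ
  r = + a / suc b
  η = + 1 / suc s
  w = (+ v / 1) ℚ.* lg
  expand : ∀ r η w → (r ℚ.- η) ℚ.* w ≡ r ℚ.* w ℚ.- η ℚ.* w
  expand = solve 3 (λ r η w → (r :- η) :* w := r :* w :- η :* w) refl
    where open +-*-Solver
  cancel : ∀ x y → x ℚ.+ y ℚ.- y ≡ x
  cancel = solve 2 (λ x y → x :+ y :- y := x) refl
    where open +-*-Solver
  times-v-log : ∀ x d k → (+ x / suc d) ℚ.* ((+ v / 1) ℚ.* (+ k / 1)) ≡ + (x * (v * k)) / suc d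
  times-v-log x d k = trans (cong ((+ x / suc d) ℚ.*_) (/-* v 0 k)) (/-* x d (v * k))
  mono : ∀ x d {y z} → y ℚ.≤ z →
    (+ x / suc d) ℚ.* ((+ v / 1) ℚ.* y) ℚ.≤ (+ x / suc d) ℚ.* ((+ v / 1) ℚ.* z)
  mono x d y≤z = ℚ.*-monoˡ-≤-nonNeg (+ x / suc d) {{/-nonNeg x d}}
    (ℚ.*-monoˡ-≤-nonNeg (+ v / 1) {{/-nonNeg v 0}} y≤z)
  e-over : + e / 1 ≡ + (e * suc s) / suc s
  e-over = ℚ.≤-antisym (/-mono-≤ e (e * suc s) 0 s (≤-reflexive (sym (*-identityʳ _))))
                       (/-mono-≤ (e * suc s) e s 0 (≤-reflexive (*-identityʳ _)))
  cross : a * (v * suc ℓ) * suc s ≤ (e * suc s + 1 * (v * ℓ)) * suc b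
  cross = subst₂ _≤_ (*-comm (suc s) _) (rearrange (suc s) (suc b) e (v * ℓ)) nat
    where
    rearrange : ∀ S b e x → S * (b * e) + b * x ≡ (e * S + 1 * x) * b
    rearrange = solve-∀
  rw≤ : r ℚ.* w ℚ.≤ + e / 1 ℚ.+ η ℚ.* w
  rw≤ = begin
    r ℚ.* w
      ≤⟨ mono a b lg≤1+ℓ ⟩
    r ℚ.* ((+ v / 1) ℚ.* (+ suc ℓ / 1))
      ≡⟨ times-v-log a b (suc ℓ) ⟩
    + (a * (v * suc ℓ)) / suc b
      ≤⟨ /-mono-≤ (a * (v * suc ℓ)) (e * suc s + 1 * (v * ℓ)) b s cross ⟩
    + (e * suc s + 1 * (v * ℓ)) / suc s
      ≡⟨ /-+ (e * suc s) (1 * (v * ℓ)) s ⟩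
    + (e * suc s) / suc s ℚ.+ + (1 * (v * ℓ)) / suc s
      ≡⟨ cong₂ ℚ._+_ e-over (times-v-log 1 s ℓ) ⟨
    + e / 1 ℚ.+ η ℚ.* ((+ v / 1) ℚ.* (+ ℓ / 1))
      ≤⟨ ℚ.+-monoʳ-≤ (+ e / 1) (mono 1 s ℓ≤lg) ⟩
    + e / 1 ℚ.+ η ℚ.* w ∎

EdgeBound : ℝ → ℕ → ℝ → ℕ → Set
EdgeBound c n ε v = ∀ e → IsMinEdges v n e →
  fromℕ e ≥ℝ (c +ℝ ε) *ℝ (fromℕ v *ℝ log₂ v)

1/>0 : ∀ s → 0ℚ ℚ.< + 1 / suc s
1/>0 s = ℚ.positive⁻¹ (+ 1 / suc s) {{ℚ.normalize-pos 1 (suc s)}}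

edge-bound-up-to : ∀ t c → CoveringArrayBound t c → ∀ s →
  ∃[ V ] (∀ v → V ≤ v → EdgeBound c (suc t) (fromℚ (ℚ.- slack s)) v)
-- The 1 keeps `v` positive, away from the dummy value of `log₂` at 0. The integer bound is applied
-- to a graph attaining the minimum.
edge-bound-up-to t c ca-bound s = 1 ⊔ V , λ v V≤v e ((G , ec , ∣E∣≡e) , _) ε ε>0 →
  M , λ m M≤m →
  bound v e ε m ε>0 (m⊔n≤o⇒m≤o 1 V V≤v) M≤m
    (subst (Nat-bound v) ∣E∣≡e (edges v (m⊔n≤o⇒n≤o 1 V V≤v) G ec))
  where
  rational : RationalLowerBound t c _
  rational = rationalLowerBound t c (+ 1 / suc s) (1/>0 s) ca-bound
  a b M V : ℕ
  a = proj₁ rational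
  b = proj₁ (proj₂ rational)
  M = proj₁ (proj₂ (proj₂ (proj₂ (proj₂ rational))))
  c≤ = proj₂ (proj₂ (proj₂ (proj₂ (proj₂ rational))))
  large = edges-bound t a (suc b) (suc s) (proj₁ (proj₂ (proj₂ rational))) (proj₁ (proj₂ (proj₂ (proj₂ rational))))
  V = proj₁ large
  edges = proj₂ large
  Nat-bound : ℕ → ℕ → Set
  Nat-bound v e =
    suc s * (a * (v * suc ⌊log₂ v ⌋)) ≤ suc s * (suc b * e) + suc b * (v * ⌊log₂ v ⌋)
  open ℚ.≤-Reasoning
  bound : ∀ v e ε m → 0ℚ ℚ.< ε → 1 ≤ v → M ≤ m → Nat-bound v e →
    (seq c m ℚ.- slack s) ℚ.* ((+ v / 1) ℚ.* seq (log₂ v) m) ℚ.≤ + e / 1 ℚ.+ ε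
  bound v@(suc _) e ε m ε>0 1≤v M≤m nat = begin
    (seq c m ℚ.- slack s) ℚ.* w
      ≤⟨ ℚ.*-monoʳ-≤-nonNeg w {{w-nonNeg}} (slack-absorbs (seq c m) (+ a / suc b) s (c≤ m M≤m)) ⟩
    (+ a / suc b ℚ.- + 1 / suc s) ℚ.* w
      ≤⟨ rational-edges-bound a b s v e (log₂-seq v m) nat (floor-≤-log₂-seq v m) (log₂-seq-≤-suc-floor v m) ⟩
    + e / 1
      ≤⟨ p≤p+ε ε>0 ⟩
    + e / 1 ℚ.+ ε ∎
    where
    w : ℚ
    w = (+ v / 1) ℚ.* log₂-seq v m
    w-nonNeg : ℚ.NonNegative w
    w-nonNeg = ℚ.nonNeg*nonNeg⇒nonNeg (+ v / 1) {{/-nonNeg v 0}} (log₂-seq v m) {{/-nonNeg ⌊log₂ (v ^ suc m) ⌋ m}}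

slack→0 : ∀ (f : ℕ → ℕ) → (∀ m → ∃[ K ] (∀ k → K ≤ k → m ≤ f k)) →
  (λ k → fromℚ (ℚ.- slack (f k))) IsLittleO1
slack→0 f f→∞ ε ε>0 =
  let θ , θ>0 , 5θ≡ε = scale-to (+ 5 / 1) ε (ℚ.positive⁻¹ (+ 5 / 1)) ε>0
      m , 1/≤θ = 1/-archimedean θ θ>0
      K , m≤f = f→∞ m
  in K , λ k K≤k →
    let slack≤ε = subst (slack (f k) ℚ.≤_) 5θ≡ε
                   (ℚ.*-monoˡ-≤-nonNeg (+ 5 / 1) (1/≤θ (f k) (m≤f k K≤k)))
    in constant (ℚ.neg-antimono-≤ slack≤ε)
     , constant (ℚ.≤-trans (ℚ.neg-antimono-≤ (0≤slack (f k))) (ℚ.<⇒≤ ε>0))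
  where
  constant : ∀ {p q} → p ℚ.≤ q → fromℚ p ≤ℝ fromℚ q
  constant p≤q ε ε>0 = 0 , λ _ _ → ℚ.≤-trans p≤q (p≤p+ε ε>0)
  0≤slack : ∀ s → 0ℚ ℚ.≤ slack s
  0≤slack s = ℚ.nonNegative⁻¹ _
    {{ℚ.nonNeg*nonNeg⇒nonNeg (+ 5 / 1) (+ 1 / suc s) {{/-nonNeg 1 s}}}}

-- At each `v` the bound is taken with the precision that `diagonalise` provides there, so `δ v` is
-- minus the corresponding slack.
edges-asymptotics : ∀ n c → 3 ≤ n → CoveringArrayBound (n ∸ 1) c →
  ∃[ δ ] (δ IsLittleO1 × ∃[ V ] (∀ v e → V ≤ v → IsMinEdges v n e →
    fromℕ e ≥ℝ (c +ℝ δ v) *ℝ (fromℕ v *ℝ log₂ v)))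
edges-asymptotics (suc t) c _ ca-bound =
  let f , f→∞ , V , bound = diagonalise (λ s → EdgeBound c (suc t) (fromℚ (ℚ.- slack s)))
                                        (edge-bound-up-to t c ca-bound)
  in (λ v → fromℚ (ℚ.- slack (f v))) , slack→0 f f→∞ , V , λ v e V≤v → bound v V≤v e

theorem15 : (c : ℕ → ℝ) → KleitmanSpencer c →
    (n : ℕ) → 3 ≤ n →
    ∃[ δ ] (δ IsLittleO1 ×
    ∃[ V ] (∀ v e → V ≤ v → IsMinEdges v n e →
    fromℕ e ≥ℝ (c (n ∸ 1) +ℝ δ v) *ℝ (fromℕ v *ℝ log₂ v)))
theorem15 c ks n 3≤n =
  edges-asymptotics n (c (n ∸ 1)) 3≤n (proj₁ ks (n ∸ 1) (∸-monoˡ-≤ 1 3≤n))
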